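{- In the graceful game, Bob has a winning strategy on every prism $P_{r,2}=C_r\,\square\,P_2$, $r\geq 3$ (no matter who starts).
   Context: $C_r$ is the cycle on $r$ vertices, $P_2$ the path on $2$ vertices, and $\square$ the Cartesian product of graphs. A graceful labeling of a graph $G$ with $m$ edges is an injective map $f\colon V(G)\to\{0,1,\dots,m\}$ such that the induced edge labels $|f(u)-f(v)|$, $uv\in E(G)$, are pairwise distinct. The graceful game on a simple graph $G$ with $m$ edges: two players, Alice and Bob, alternately choose a free (not yet labeled) vertex and assign to it a label from $\{0,1,\dots,m\}$ not yet used. An edge both of whose endpoints are labeled gets label $|f(u)-f(v)|$; a move is legal only if after it all edge labels are pairwise distinct. Alice wins if the whole graph ends up gracefully labeled; Bob wins if he can prevent this. Either player may be the first to move. -}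

module Defs where

open import Data.Nat using (ℕ; zero; suc; _≤_; ∣_-_∣)
open import Data.Nat.DivMod using (_mod_)
open import Data.Fin using (Fin; toℕ) renaming (zero to fzero; suc to fsuc)
open import Data.Fin.Properties using () renaming (_≟_ to _≟ᶠ_)
open import Data.Product using (_×_; _,_)
open import Data.Product.Properties using (≡-dec)
open import Data.List using (List; []; _∷_; _++_; length; map; concatMap; mapMaybe; allFin)
open import Data.List.Relation.Unary.Unique.Propositional using (Unique)
open import Data.Maybe using (Maybe; just; nothing; Is-just)
open import Relation.Binary.Definitions using (DecidableEquality)
open import Relation.Binary.PropositionalEquality using (_≡_; _≢_)
open import Relation.Nullary using (¬_; yes; no)

-- Finite simple graphs given by a vertex type with decidable equality
-- and a list of (undirected) edges.

record Graph : Set₁ where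
  field
    V     : Set
    _≟V_  : DecidableEquality V
    edges : List (V × V)

  m : ℕ
  m = length edges

cycNext : ∀ {r} → Fin r → Fin r
cycNext {suc k} i = suc (toℕ i) mod (suc k)

prismEdges : (r : ℕ) → List ((Fin r × Fin 2) × (Fin r × Fin 2))
prismEdges r = concatMap (λ i →
      ((i , fzero)      , (cycNext i , fzero))
    ∷ ((i , fsuc fzero) , (cycNext i , fsuc fzero))
    ∷ ((i , fzero)      , (i , fsuc fzero))
    ∷ []) (allFin r)

Prism : ℕ → Graph
Prism r = record
  { V = Fin r × Fin 2
  ; _≟V_ = ≡-dec _≟ᶠ_ _≟ᶠ_
  ; edges = prismEdges r
  }

data Player : Set where
  alice bob : Player

module GracefulGame (G : Graph) where
  open Graph G

  Position : Set
  Position = V → Maybe ℕ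

  empty : Position
  empty _ = nothing

  assign : Position → V → ℕ → Position
  assign p v l w with w ≟V v
  ... | yes _ = just l
  ... | no  _ = p w

  edgeLabel : Position → V × V → Maybe ℕ
  edgeLabel p (u , v) with p u | p v
  ... | just a | just b = just ∣ a - b ∣
  ... | _      | _      = nothing

  edgeLabels : Position → List ℕ
  edgeLabels p = mapMaybe (edgeLabel p) edges

  Complete : Position → Set
  Complete p = ∀ v → Is-just (p v)

  record Legal (p : Position) (v : V) (l : ℕ) : Set where
    field
      free     : p v ≡ nothing
      inRange  : l ≤ m
      unused   : ∀ w → p w ≢ just l
      distinct : Unique (edgeLabels (assign p v l))

  -- BobWins s p : Bob has a winning strategy from position p with player s to move.
  -- The game is finite (each move labels a new vertex), so strategies are
  -- well-founded trees.  Alice wins iff the graph becomes fully labeled;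
  -- if the player to move has no legal move on an incomplete labeling,
  -- the game ends and Bob wins.
  data BobWins : Player → Position → Set where
    aliceTurn : ∀ {p} → ¬ Complete p →
                (∀ v l → Legal p v l → BobWins bob (assign p v l)) →
                BobWins alice p
    bobMove   : ∀ {p} v l → ¬ Complete p → Legal p v l →
                BobWins alice (assign p v l) → BobWins bob p
    bobStuck  : ∀ {p} → ¬ Complete p → (∀ v l → ¬ Legal p v l) →
                BobWins bob p

BobWinsGracefulGame : Graph → Player → Set
BobWinsGracefulGame G first = GracefulGame.BobWins G first (GracefulGame.empty G)

{-# OPTIONS --safe #-}
module Submission where

-- A graceful labelling realises every edge label 1, …, m.  So 0 and m are adjacent, the label
-- m ∸ 1 joins 0 to m ∸ 1 or 1 to m, and so on; once Bob has made one of the largest labels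
-- impossible, Alice has lost whatever is played afterwards.
--
-- Let r ≥ 4, so that there are no triangles.  If Alice opens with x, we may take x < m ∸ 1 by
-- complementing.  Bob puts 0 on the other end of the rung.  At his next move he can put m away from
-- 0, or else 1 (2 if x = 1) on a free neighbour of 0: then m can only be on the third neighbour of 0
-- and the label m ∸ 1 is impossible.  If Bob opens, he plays 0, and the only answer is m on a
-- neighbour b.  He puts 1 on a second neighbour of 0, so that m ∸ 1 has to go to the third one, y′.
-- If Alice plays that, Bob puts 2 away from b and the label m ∸ 2 is impossible; otherwise he spoils
-- y′ with another label, which exists because at most 11 of the m + 1 ≥ 13 labels are excluded.
-- The case r = 3 is a finite search.

open import Defs
open import Data.Bool using (Bool; true; false; T; T?)
open import Data.Empty using (⊥; ⊥-elim)
open import Data.Fin using (Fin; toℕ) renaming (zero to fzero; suc to fsuc)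
open import Data.Fin.Properties using (toℕ-injective; toℕ<n; toℕ-fromℕ<) renaming (_≟_ to _≟ᶠ_)
open import Data.List using (List; []; _∷_; _++_; length; map; mapMaybe; upTo; concatMap; allFin; cartesianProduct)
open import Data.List.Membership.Propositional using (_∈_; _∉_; find; lose)
open import Data.List.Membership.Propositional.Properties
  using (∈-∃++; ∈-++⁻; ∈-++⁺ˡ; ∈-++⁺ʳ; ∈-upTo⁺; ∈-upTo⁻; ∈-map⁺; ∈-map⁻;
         ∈-concatMap⁺; ∈-concatMap⁻; ∈-allFin; ∈-cartesianProduct⁺)
import Data.List.Membership.DecPropositional as DecMembership
open import Data.List.Properties using (length-++; length-map; length-upTo; length-tabulate)
open import Data.List.Relation.Binary.Subset.Propositional using (_⊆_)
open import Data.List.Relation.Unary.All as All using (All; []; _∷_)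
import Data.List.Relation.Unary.All.Properties as Allₚ
open import Data.List.Relation.Unary.AllPairs as AllPairs using ([]; _∷_; allPairs?)
import Data.List.Relation.Unary.AllPairs.Properties as AllPairsₚ
open import Data.List.Relation.Unary.Any as Any using (Any; here; there)
open import Data.List.Relation.Unary.Unique.Propositional using (Unique)
import Data.List.Relation.Unary.Unique.Propositional.Properties as Uniqueₚ
open import Data.Maybe using (Maybe; just; nothing; Is-just)
open import Data.Maybe.Properties using (just-injective) renaming (≡-dec to maybe-≡-dec)
open import Data.Nat using (ℕ; zero; suc; _+_; _*_; _∸_; _≤_; _<_; z≤n; s≤s; _≟_; _≤?_; ∣_-_∣; ⌊_/2⌋)
open import Data.Nat.DivMod using (_%_; _/_; m≡m%n+[m/n]*n; %-distribˡ-+; m%n%n≡m%n; m<n⇒m%n≡m; [m+n]%n≡m%n)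
open import Data.Nat.Properties hiding (_≟_; _≤?_)
open import Data.Product using (Σ; ∃; ∃₂; _×_; _,_; proj₁; proj₂)
open import Data.Product.Properties using (≡-dec)
open import Data.Sum as Sum using (_⊎_; inj₁; inj₂)
open import Function using (_∘_)
open import Relation.Binary.PropositionalEquality
open import Relation.Nullary using (¬_; Dec; yes; no; does; ¬?; _×-dec_; _⊎-dec_)
open import Relation.Nullary.Decidable using (map′)

-- Lists and numbers

-- Induction on `xs`: cut one occurrence of `x` out of `ys`; the tail still fits into what remains,
-- because its entries differ from `x`.
unique-⊆⇒length≤ : ∀ {A : Set} {xs ys : List A} → Unique xs → xs ⊆ ys → length xs ≤ length ys
unique-⊆⇒length≤ [] _ = z≤n
unique-⊆⇒length≤ {xs = x ∷ xs} (x∉xs ∷ uxs) xs⊆ys with ∈-∃++ (xs⊆ys (here refl))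
... | as , bs , refl = begin
  suc (length xs)             ≤⟨ s≤s (unique-⊆⇒length≤ uxs rest) ⟩
  suc (length (as ++ bs))     ≡⟨ cong suc (length-++ as) ⟩
  suc (length as + length bs) ≡⟨ +-suc (length as) (length bs) ⟨
  length as + suc (length bs) ≡⟨ length-++ as ⟨
  length (as ++ x ∷ bs)       ∎
  where
  open ≤-Reasoning
  rest : xs ⊆ as ++ bs
  rest y∈xs with ∈-++⁻ as (xs⊆ys (there y∈xs))
  ... | inj₁ y∈as         = ∈-++⁺ˡ y∈as
  ... | inj₂ (here y≡x)   = ⊥-elim (All.lookup x∉xs y∈xs (sym y≡x))
  ... | inj₂ (there y∈bs) = ∈-++⁺ʳ as y∈bs

open DecMembership _≟_ using (_∈?_)

-- Pigeonhole: there is one more candidate than there are bad numbers. The bound on `j` later makes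
-- it a legitimate label.
fresh : (bad : List ℕ) → ∃ λ j → j ≤ length bad × j ∉ bad
fresh bad with Any.any? (λ j → ¬? (j ∈? bad)) (upTo (suc (length bad)))
... | yes found = let j , j∈ , j∉ = find found in j , ≤-pred (∈-upTo⁻ j∈) , j∉
... | no none = ⊥-elim (<-irrefl refl (begin-strict
  length bad                    <⟨ n<1+n _ ⟩
  suc (length bad)              ≡⟨ length-upTo _ ⟨
  length (upTo (suc (length bad))) ≤⟨ unique-⊆⇒length≤ (Uniqueₚ.upTo⁺ _) all∈ ⟩
  length bad                    ∎))
  where
  open ≤-Reasoning
  all∈ : upTo (suc (length bad)) ⊆ bad
  all∈ {j} j∈ with j ∈? bad
  ... | yes p = p
  ... | no ¬p = ⊥-elim (none (lose j∈ ¬p))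

module _ {A B : Set} (f : A → Maybe B) where

  ∈-mapMaybe⁺ : ∀ {xs x k} → x ∈ xs → f x ≡ just k → k ∈ mapMaybe f xs
  ∈-mapMaybe⁺ {y ∷ xs} (here refl) eq rewrite eq = here refl
  ∈-mapMaybe⁺ {y ∷ xs} (there x∈)  eq with f y
  ... | just _  = there (∈-mapMaybe⁺ x∈ eq)
  ... | nothing = ∈-mapMaybe⁺ x∈ eq

  ∈-mapMaybe⁻ : ∀ xs {k} → k ∈ mapMaybe f xs → ∃ λ x → x ∈ xs × f x ≡ just k
  ∈-mapMaybe⁻ (y ∷ xs) k∈ with f y in eq | k∈
  ... | just _  | here refl = y , here refl , eq
  ... | just _  | there k∈′ = let x , x∈ , e = ∈-mapMaybe⁻ xs k∈′ in x , there x∈ , e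
  ... | nothing | k∈′       = let x , x∈ , e = ∈-mapMaybe⁻ xs k∈′ in x , there x∈ , e

  -- With its converse below, this turns the list condition in `Legal` into injectivity of the
  -- partial map from edges to labels.
  mapMaybe-unique⁺ : ∀ {xs} → Unique xs →
    (∀ {x y k} → x ∈ xs → y ∈ xs → f x ≡ just k → f y ≡ just k → x ≡ y) →
    Unique (mapMaybe f xs)
  mapMaybe-unique⁺ [] _ = []
  mapMaybe-unique⁺ {x ∷ xs} (x∉ ∷ uxs) inj
    with rest ← mapMaybe-unique⁺ uxs (λ x∈ y∈ → inj (there x∈) (there y∈)) | f x in eq
  ... | nothing = rest
  ... | just k  = All.tabulate (λ l∈ k≡l → let y , y∈ , e = ∈-mapMaybe⁻ xs l∈ in
      All.lookup x∉ y∈ (inj (here refl) (there y∈) eq (trans e (cong just (sym k≡l)))))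
    ∷ rest

  mapMaybe-unique⁻ : ∀ {xs x y k} → Unique (mapMaybe f xs) → x ∈ xs → y ∈ xs →
    f x ≡ just k → f y ≡ just k → x ≡ y
  mapMaybe-unique⁻ u (here refl) (here refl) _ _ = refl
  mapMaybe-unique⁻ u (here refl) (there y∈) ex ey rewrite ex with u
  ... | k∉ ∷ _ = ⊥-elim (All.lookup k∉ (∈-mapMaybe⁺ y∈ ey) refl)
  mapMaybe-unique⁻ u (there x∈) (here refl) ex ey rewrite ey with u
  ... | k∉ ∷ _ = ⊥-elim (All.lookup k∉ (∈-mapMaybe⁺ x∈ ex) refl)
  mapMaybe-unique⁻ {z ∷ _} u (there x∈) (there y∈) ex ey with f z | u
  ... | nothing | u′     = mapMaybe-unique⁻ u′ x∈ y∈ ex ey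
  ... | just _  | _ ∷ u′ = mapMaybe-unique⁻ u′ x∈ y∈ ex ey

∣-∣≡⇒+ : ∀ i j {k} → ∣ i - j ∣ ≡ k → i ≡ j + k ⊎ j ≡ i + k
∣-∣≡⇒+ zero    j       refl = inj₂ refl
∣-∣≡⇒+ (suc i) zero    refl = inj₁ refl
∣-∣≡⇒+ (suc i) (suc j) eq with ∣-∣≡⇒+ i j eq
... | inj₁ e = inj₁ (cong suc e)
... | inj₂ e = inj₂ (cong suc e)

-- Plays of the graceful game on a simple graph

-- Labels are read through an isometry of {0,…,m}, so that one argument serves a labelling and its complement.
record Isometry (m : ℕ) : Set where
  field
    ℓ       : ℕ → ℕ
    ℓ≤      : ∀ {i} → i ≤ m → ℓ i ≤ m
    ℓ∘ℓ     : ∀ {i} → i ≤ m → ℓ (ℓ i) ≡ i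
    ℓ-dist  : ∀ {i j} → i ≤ m → j ≤ m → ∣ ℓ i - ℓ j ∣ ≡ ∣ i - j ∣

  ℓ-injective : ∀ {i j} → i ≤ m → j ≤ m → ℓ i ≡ ℓ j → i ≡ j
  ℓ-injective i≤ j≤ eq = trans (sym (ℓ∘ℓ i≤)) (trans (cong ℓ eq) (ℓ∘ℓ j≤))

identity : ∀ {m} → Isometry m
identity = record { ℓ = λ i → i ; ℓ≤ = λ p → p ; ℓ∘ℓ = λ _ → refl ; ℓ-dist = λ _ _ → refl }

∣m∸i-m∸j∣ : ∀ m {i j} → i ≤ m → j ≤ m → ∣ m ∸ i - m ∸ j ∣ ≡ ∣ i - j ∣
∣m∸i-m∸j∣ m {zero} {j} _ j≤ = trans (m≤n⇒∣n-m∣≡n∸m (m∸n≤m m j)) (m∸[m∸n]≡n j≤)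
∣m∸i-m∸j∣ m {suc i} {zero} i≤ _ = trans (m≤n⇒∣m-n∣≡n∸m (m∸n≤m m (suc i))) (m∸[m∸n]≡n i≤)
∣m∸i-m∸j∣ (suc m) {suc i} {suc j} (s≤s i≤) (s≤s j≤) = ∣m∸i-m∸j∣ m i≤ j≤

complement : ∀ {m} → Isometry m
complement {m} = record
  { ℓ = m ∸_ ; ℓ≤ = λ {i} _ → m∸n≤m m i ; ℓ∘ℓ = m∸[m∸n]≡n ; ℓ-dist = ∣m∸i-m∸j∣ m }

-- Asymmetry excludes loops (take `u` equal to `v`) as well as an edge listed in both directions, so
-- each unordered pair occurs at most once.
record Simple (G : Graph) : Set where
  open Graph G
  field
    vertices     : List V
    ∈-vertices   : ∀ v → v ∈ vertices
    edges-unique : Unique edges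
    edges-asym   : ∀ {u v} → (u , v) ∈ edges → (v , u) ∉ edges

module Game (G : Graph) (simple : Simple G) (isometry : Isometry (Graph.m G)) where
  open Graph G public
  open Simple simple public
  open Isometry isometry public
  open GracefulGame G public

  Adj : V → V → Set
  Adj u v = (u , v) ∈ edges ⊎ (v , u) ∈ edges

  Adj-sym : ∀ {u v} → Adj u v → Adj v u
  Adj-sym (inj₁ e) = inj₂ e
  Adj-sym (inj₂ e) = inj₁ e

  Adj-irrefl : ∀ {v} → ¬ Adj v v
  Adj-irrefl (inj₁ e) = edges-asym e e
  Adj-irrefl (inj₂ e) = edges-asym e e

  adj? : ∀ u v → Dec (Adj u v)
  adj? u v = (u , v) ∈ₑ? edges ⊎-dec (v , u) ∈ₑ? edges
    where open DecMembership (≡-dec _≟V_ _≟V_) renaming (_∈?_ to _∈ₑ?_)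

  assign-eq : ∀ p v l {w} → w ≡ v → assign p v l w ≡ just l
  assign-eq p v l {w} eq with w ≟V v
  ... | yes _ = refl
  ... | no ¬p = ⊥-elim (¬p eq)

  assign-neq : ∀ p v l {w} → w ≢ v → assign p v l w ≡ p w
  assign-neq p v l {w} ne with w ≟V v
  ... | yes e = ⊥-elim (ne e)
  ... | no _  = refl

  edgeLabel⁻ : ∀ p u v {k} → edgeLabel p (u , v) ≡ just k →
    ∃₂ λ i j → p u ≡ just i × p v ≡ just j × k ≡ ∣ i - j ∣
  edgeLabel⁻ p u v eq with p u | p v
  ... | just i | just j = i , j , refl , refl , just-injective (sym eq)

  edgeLabel⁺ : ∀ p u v {i j} → p u ≡ just i → p v ≡ just j → edgeLabel p (u , v) ≡ just ∣ i - j ∣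
  edgeLabel⁺ p u v eu ev rewrite eu | ev = refl

  legal? : ∀ p v l → Dec (Legal p v l)
  legal? p v l = map′
    (λ (f , r , u , d) → record { free = f ; inRange = r
       ; unused = λ w → All.lookup u (∈-vertices w) ; distinct = d })
    (λ leg → let open Legal leg in
       free , inRange , All.tabulate (λ {w} _ → unused w) , distinct)
    (maybe-≡-dec _≟_ (p v) nothing ×-dec l ≤? m
      ×-dec All.all? (λ w → ¬? (maybe-≡-dec _≟_ (p w) (just l))) vertices
      ×-dec allPairs? (λ i j → ¬? (i ≟ j)) _)

  anyLegal? : ∀ p → Dec (∃₂ λ v l → Legal p v l)
  anyLegal? p = map′
    (λ a → let v , b = Any.satisfied a ; l , leg = Any.satisfied b in v , l , leg)
    (λ (v , l , leg) → lose (∈-vertices v) (lose (∈-upTo⁺ (s≤s (Legal.inRange leg))) leg))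
    (Any.any? (λ v → Any.any? (legal? p v) (upTo (suc m))) vertices)

  -- Plays as lists of moves.

  Moves : Set
  Moves = List (V × ℕ)

  -- The latest move stands at the head. Moves carry the labels in which the strategy thinks; `ℓ`
  -- converts them to those on the board.
  pos : Moves → Position
  pos []            = empty
  pos ((v , l) ∷ s) = assign (pos s) v (ℓ l)

  -- `Legal` bounds only `ℓ l`, not `l` itself, and `ℓ` is known to be an isometric involution only
  -- up to `m`.
  data Play : Moves → Set where
    []  : Play []
    _∷_ : ∀ {v l s} → l ≤ m × Legal (pos s) v (ℓ l) → Play s → Play ((v , l) ∷ s)

  pos⇒∈ : ∀ s {u k} → pos s u ≡ just k → ∃ λ l → (u , l) ∈ s × k ≡ ℓ l
  pos⇒∈ ((v , l) ∷ s) {u} eq with u ≟V v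
  pos⇒∈ ((v , l) ∷ s) refl | yes refl = l , here refl , refl
  ... | no _ = let l′ , u∈ , e = pos⇒∈ s eq in l′ , there u∈ , e

  ∈⇒pos : ∀ {s u l} → Play s → (u , l) ∈ s → pos s u ≡ just (ℓ l)
  ∈⇒pos {(v , l) ∷ s} (_ ∷ _) (here refl) = assign-eq (pos s) v (ℓ l) refl
  ∈⇒pos {(v , l) ∷ s} {u} ((_ , leg) ∷ play) (there u∈) =
    trans (assign-neq (pos s) v (ℓ l) u≢v) eq
    where
    eq = ∈⇒pos play u∈
    u≢v : u ≢ v
    u≢v refl with trans (sym eq) (Legal.free leg)
    ... | ()

  bounded : ∀ {s u l} → Play s → (u , l) ∈ s → l ≤ m
  bounded ((l≤ , _) ∷ _) (here refl) = l≤
  bounded (_ ∷ play)     (there u∈)  = bounded play u∈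

  functional : ∀ {s u l l′} → Play s → (u , l) ∈ s → (u , l′) ∈ s → l ≡ l′
  functional play p q = ℓ-injective (bounded play p) (bounded play q)
    (just-injective (trans (sym (∈⇒pos play p)) (∈⇒pos play q)))

  Free : Moves → V → Set
  Free s v = ∀ {l} → (v , l) ∉ s

  Unused : Moves → ℕ → Set
  Unused s l = ∀ {v} → (v , l) ∉ s

  head-free : ∀ {v l s} → Play ((v , l) ∷ s) → Free s v
  head-free ((_ , leg) ∷ play) v∈ with trans (sym (∈⇒pos play v∈)) (Legal.free leg)
  ... | ()

  head-unused : ∀ {v l s} → Play ((v , l) ∷ s) → Unused s l
  head-unused ((_ , leg) ∷ play) v∈ = Legal.unused leg _ (∈⇒pos play v∈)

  injective : ∀ {s u v l} → Play s → (u , l) ∈ s → (v , l) ∈ s → u ≡ v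
  injective _              (here refl) (here refl) = refl
  injective play           (here refl) (there v∈)  = ⊥-elim (head-unused play v∈)
  injective play           (there u∈)  (here refl) = ⊥-elim (head-unused play u∈)
  injective (_ ∷ play)     (there u∈)  (there v∈)  = injective play u∈ v∈

  free⇒nothing : ∀ s {v} → Free s v → pos s v ≡ nothing
  free⇒nothing s {v} fr with pos s v in eq
  ... | nothing = refl
  ... | just _  = ⊥-elim (fr (proj₁ (proj₂ (pos⇒∈ s eq))))

  ¬complete : ∀ {s v} → Free s v → ¬ Complete (pos s)
  ¬complete {s} {v} fr c with pos s v | free⇒nothing s fr | c v
  ... | nothing | _ | ()

  play-unique : ∀ {s} → Play s → Unique (edgeLabels (pos s))
  play-unique []              = subst Unique (sym (none edges)) []
    where
    none : ∀ es → mapMaybe (edgeLabel empty) es ≡ []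
    none []       = refl
    none (_ ∷ es) = none es
  play-unique ((_ , leg) ∷ _) = Legal.distinct leg

  labelled : ∀ {s} → Play s → ∀ {u v k} → edgeLabel (pos s) (u , v) ≡ just k →
    ∃₂ λ i j → (u , i) ∈ s × (v , j) ∈ s × k ≡ ∣ i - j ∣
  labelled {s} play {u} {v} eq =
    let i , j , eu , ev , k≡ = edgeLabel⁻ (pos s) u v eq
        i′ , u∈ , ei = pos⇒∈ s eu
        j′ , v∈ , ej = pos⇒∈ s ev
    in i′ , j′ , u∈ , v∈ , trans k≡ (trans (cong₂ ∣_-_∣ ei ej) (ℓ-dist (bounded play u∈) (bounded play v∈)))

  label : ∀ {s} → Play s → ∀ {u v i j} → (u , i) ∈ s → (v , j) ∈ s →
    edgeLabel (pos s) (u , v) ≡ just ∣ i - j ∣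
  label {s} play {u} {v} u∈ v∈ = trans (edgeLabel⁺ (pos s) u v (∈⇒pos play u∈) (∈⇒pos play v∈))
    (cong just (ℓ-dist (bounded play u∈) (bounded play v∈)))

  -- Graceful labellings and doomed positions.

  record Graceful (q : V → ℕ) : Set where
    field
      q-injective : ∀ {u v} → q u ≡ q v → u ≡ v
      q-bounded   : ∀ v → q v ≤ m
      q-distinct  : ∀ {u v u′ v′} → (u , v) ∈ edges → (u′ , v′) ∈ edges →
                    ∣ q u - q v ∣ ≡ ∣ q u′ - q v′ ∣ → (u , v) ≡ (u′ , v′)

    lab : V × V → ℕ
    lab (u , v) = ∣ q u - q v ∣

    -- Pigeonhole: if `k` were missing, `k` and the `m` distinct edge labels would be `m` + 1 values
    -- between 1 and `m`.
    edge-label : ∀ {k} → 1 ≤ k → k ≤ m → ∃₂ λ u v → Adj u v × q v ≡ q u + k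
    edge-label {k} 1≤k k≤m with k ∈? map lab edges
    ... | yes k∈ with ∈-map⁻ _ k∈
    ... | (u , v) , e∈ , k≡ with ∣-∣≡⇒+ (q u) (q v) (sym k≡)
    ... | inj₁ e = v , u , inj₂ e∈ , e
    ... | inj₂ e = u , v , inj₁ e∈ , e
    edge-label {k} 1≤k k≤m | no k∉ = ⊥-elim (<-irrefl refl (begin-strict
      m                              ≡⟨ length-map _ edges ⟨
      length (map lab edges)         <⟨ n<1+n _ ⟩
      length (k ∷ map lab edges)     ≤⟨ unique-⊆⇒length≤ uniq sub ⟩
      length (map suc (upTo m))      ≡⟨ length-map suc (upTo m) ⟩
      length (upTo m)                ≡⟨ length-upTo m ⟩
      m                              ∎))
      where
      open ≤-Reasoning
      map-unique : ∀ {es} → es ⊆ edges → Unique es → Unique (map lab es)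
      map-unique _   []         = []
      map-unique sub (e∉ ∷ ues) = All.tabulate (λ l∈ eq → let e , e∈ , l≡ = ∈-map⁻ lab l∈ in
          All.lookup e∉ e∈ (q-distinct (sub (here refl)) (sub (there e∈)) (trans eq l≡)))
        ∷ map-unique (λ e∈ → sub (there e∈)) ues
      uniq : Unique (k ∷ map lab edges)
      uniq = All.tabulate (λ l∈ k≡l → k∉ (subst (_∈ _) (sym k≡l) l∈))
        ∷ map-unique (λ e → e) edges-unique
      loopless : ∀ {u v} → (u , v) ∈ edges → u ≢ v
      loopless e∈ refl = edges-asym e∈ e∈
      range : ∀ {l} → 1 ≤ l → l ≤ m → l ∈ map suc (upTo m)
      range {suc l} _ l<m = ∈-map⁺ suc (∈-upTo⁺ l<m)
      sub : k ∷ map lab edges ⊆ map suc (upTo m)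
      sub (here refl) = range 1≤k k≤m
      sub (there l∈) with ∈-map⁻ lab l∈
      ... | (u , v) , e∈ , refl = range
        (n≢0⇒n>0 λ z → loopless e∈ (q-injective (∣m-n∣≡0⇒m≡n z)))
        (≤-trans (∣m-n∣≤m⊔n (q u) (q v)) (⊔-lub (q-bounded u) (q-bounded v)))

  -- A condition on complete labellings alone, hence inherited by every continuation of the play.
  Doomed : Moves → Set
  Doomed s = ∀ q → (∀ {u l} → (u , l) ∈ s → q u ≡ l) → Graceful q → ⊥

  -- A complete play is itself a graceful labelling that extends its own moves.
  doomed⇒¬complete : ∀ {s} → Play s → Doomed s → ¬ Complete (pos s)
  doomed⇒¬complete {s} play doom complete = doom q ext record
    { q-injective = λ {u} {v} eq → injective play (q∈ u) (subst (λ l → (v , l) ∈ s) (sym eq) (q∈ v))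
    ; q-bounded   = λ v → bounded play (q∈ v)
    ; q-distinct  = λ {u} {v} {u′} {v′} e e′ eq → mapMaybe-unique⁻ (edgeLabel (pos s)) (play-unique play) e e′
        (label play (q∈ u) (q∈ v)) (trans (label play (q∈ u′) (q∈ v′)) (cong just (sym eq)))
    }
    where
    value : ∀ v → ∃ λ l → (v , l) ∈ s
    value v with pos s v in eq | complete v
    ... | just k | _ = let l , v∈ , _ = pos⇒∈ s eq in l , v∈
    q : V → ℕ
    q v = proj₁ (value v)
    q∈ : ∀ v → (v , q v) ∈ s
    q∈ v = proj₂ (value v)
    ext : ∀ {u l} → (u , l) ∈ s → q u ≡ l
    ext u∈ = functional play (q∈ _) u∈

  length-play : ∀ {s} → Play s → length s ≤ length vertices
  length-play {s} play = begin
    length s              ≡⟨ length-map proj₁ s ⟨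
    length (map proj₁ s)  ≤⟨ unique-⊆⇒length≤ (distinct play) (λ {v} _ → ∈-vertices v) ⟩
    length vertices       ∎
    where
    open ≤-Reasoning
    distinct : ∀ {s} → Play s → Unique (map proj₁ s)
    distinct [] = []
    distinct {(v , _) ∷ s} (leg ∷ play) = All.tabulate (λ u∈ v≡u →
        let (_ , l) , w∈ , u≡w = ∈-map⁻ proj₁ u∈ in
        head-free (leg ∷ play) (subst (λ x → (x , l) ∈ s) (sym (trans v≡u u≡w)) w∈))
      ∷ distinct play

  -- Alice's label `l` on the board enters the play as `ℓ l`; since `ℓ` is an involution on the
  -- range, all her legal moves are covered.
  alice-turn : ∀ {s} → Play s → ¬ Complete (pos s) →
    (∀ {v l} → Play ((v , l) ∷ s) → BobWins bob (pos ((v , l) ∷ s))) → BobWins alice (pos s)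
  alice-turn {s} play ¬c reply = aliceTurn ¬c λ v l leg →
    let l≤ = Legal.inRange leg
        eq = ℓ∘ℓ l≤
    in subst (λ k → BobWins bob (assign (pos s) v k)) eq
         (reply ((ℓ≤ l≤ , subst (Legal (pos s) v) (sym eq) leg) ∷ play))

  -- Any legal move of Bob will do, and having none is a win as well. The counter `n` bounds the
  -- moves still to come, as a play labels each vertex at most once; it makes the strategy
  -- well-founded.
  doomed⇒win : ∀ {s} → Play s → Doomed s → ∀ player → BobWins player (pos s)
  doomed⇒win play doom = go (length vertices) play doom (m≤m+n _ _)
    where
    go : ∀ n {s} → Play s → Doomed s → length vertices ≤ n + length s → ∀ player → BobWins player (pos s)
    next : ∀ n {s v l} → Play ((v , l) ∷ s) → Doomed s → length vertices ≤ n + length s →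
      ∀ player → BobWins player (pos ((v , l) ∷ s))
    next zero    play _    bound = ⊥-elim (<-irrefl refl (≤-trans (length-play play) bound))
    next (suc n) play doom bound =
      go n play (λ q ext → doom q (λ u∈ → ext (there u∈))) (≤-trans bound (≤-reflexive (sym (+-suc n _))))
    go n play doom bound alice =
      alice-turn play (doomed⇒¬complete play doom) (λ play′ → next n play′ doom bound bob)
    go n {s} play doom bound bob with anyLegal? (pos s)
    ... | no stuck = bobStuck (doomed⇒¬complete play doom) (λ v l leg → stuck (v , l , leg))
    ... | yes (v , l , leg) = bobMove v l (doomed⇒¬complete play doom) leg
      (subst (λ k → BobWins alice (assign (pos s) v k)) eq
        (next n ((ℓ≤ l≤ , subst (Legal (pos s) v) (sym eq) leg) ∷ play) doom bound alice))
      where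
      l≤ = Legal.inRange leg
      eq = ℓ∘ℓ l≤

  -- Legality of Bob's moves.

  Neighbours : Moves → V → List ℕ → Set
  Neighbours s v N = ∀ {n k} → (n , k) ∈ s → Adj v n → k ∈ N

  -- Like the list in `Neighbours`, `E` is only an upper bound: to rule out clashes, a superset of
  -- the labels present is enough, and not every adjacency has to be settled.
  EdgeLabels : Moves → List ℕ → Set
  EdgeLabels s E = ∀ {u i v j} → (u , i) ∈ s → (v , j) ∈ s → Adj u v → ∣ i - j ∣ ∈ E

  edgeLabels-∷ : ∀ {s E v l N} → EdgeLabels s E → Neighbours s v N →
    EdgeLabels ((v , l) ∷ s) (map ∣ l -_∣ N ++ E)
  edgeLabels-∷ E N (here refl) (here refl) adj = ⊥-elim (Adj-irrefl adj)
  edgeLabels-∷ {l = l} E N (here refl) (there v∈)  adj = ∈-++⁺ˡ (∈-map⁺ ∣ l -_∣ (N v∈ adj))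
  edgeLabels-∷ {l = l} E N (there u∈) (here refl) adj =
    ∈-++⁺ˡ (subst (_∈ _) (∣-∣-comm l _) (∈-map⁺ ∣ l -_∣ (N u∈ (Adj-sym adj))))
  edgeLabels-∷ E N (there u∈)  (there v∈)  adj = ∈-++⁺ʳ _ (E u∈ v∈ adj)

  -- An edge labelled after the move is old or joins `v` to a labelled neighbour. The last two
  -- hypotheses exclude clashes of new with old and of new with new; old labels differ because the
  -- play so far is legal.
  extend : ∀ {s v l} → Play s → Free s v → l ≤ m → Unused s l →
    ∀ {N E} → Neighbours s v N → EdgeLabels s E →
    (∀ {k} → k ∈ N → ∣ l - k ∣ ∉ E) →
    (∀ {k k′} → k ∈ N → k′ ∈ N → ∣ l - k ∣ ≡ ∣ l - k′ ∣ → k ≡ k′) →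
    Play ((v , l) ∷ s)
  extend {s} {v} {l} play free l≤ unused {N} {E} nbrs elabs new∉old new-inj = (l≤ , legal) ∷ play
    where
    p′ : Position
    p′ = assign (pos s) v (ℓ l)

    New Old : V × V → ℕ → Set
    New e k = ∃₂ λ n i → (n , i) ∈ s × Adj v n × k ≡ ∣ l - i ∣ × (e ≡ (v , n) ⊎ e ≡ (n , v))
    Old e k = edgeLabel (pos s) e ≡ just k

    value : ∀ {u k} → p′ u ≡ just k → (u ≡ v × k ≡ ℓ l) ⊎ ∃ λ i → (u , i) ∈ s × k ≡ ℓ i
    value {u} eq with u ≟V v
    ... | yes u≡v = inj₁ (u≡v , just-injective (sym eq))
    ... | no _    = inj₂ (pos⇒∈ s eq)

    dist : ∀ {i} {u} → (u , i) ∈ s → ∣ ℓ l - ℓ i ∣ ≡ ∣ l - i ∣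
    dist u∈ = ℓ-dist l≤ (bounded play u∈)

    classify : ∀ {e k} → e ∈ edges → edgeLabel p′ e ≡ just k → New e k ⊎ Old e k
    classify {u , w} e∈ eq with edgeLabel⁻ p′ u w eq
    ... | i , j , eu , ew , refl with value eu | value ew
    ... | inj₁ (refl , _)       | inj₁ (refl , _)       = ⊥-elim (Adj-irrefl (inj₁ e∈))
    ... | inj₁ (refl , refl)    | inj₂ (j′ , w∈ , refl) = inj₁ (w , j′ , w∈ , inj₁ e∈ , dist w∈ , inj₁ refl)
    ... | inj₂ (i′ , u∈ , refl) | inj₁ (refl , refl)    =
      inj₁ (u , i′ , u∈ , inj₂ e∈ , trans (∣-∣-comm (ℓ i′) (ℓ l)) (dist u∈) , inj₂ refl)
    ... | inj₂ (i′ , u∈ , refl) | inj₂ (j′ , w∈ , refl) =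
      inj₂ (edgeLabel⁺ (pos s) u w (∈⇒pos play u∈) (∈⇒pos play w∈))

    new≢old : ∀ {e e′ k} → e′ ∈ edges → New e k → ¬ Old e′ k
    new≢old e′∈ (n , i , n∈ , adj , k≡ , _) old =
      let i′ , j′ , u∈ , w∈ , k≡′ = labelled play old
      in new∉old (nbrs n∈ adj) (subst (_∈ E) (trans (sym k≡′) k≡) (elabs u∈ w∈ (inj₁ e′∈)))

    new-new : ∀ {e e′ k} → e ∈ edges → e′ ∈ edges → New e k → New e′ k → e ≡ e′
    -- Equal new labels come from equal neighbour labels, hence from the same neighbour; the edges
    -- could then differ only in orientation.
    new-new e∈ e′∈ (n , i , n∈ , adj , k≡ , o) (n′ , i′ , n′∈ , adj′ , k≡′ , o′)
      with new-inj (nbrs n∈ adj) (nbrs n′∈ adj′) (trans (sym k≡) k≡′)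
    ... | refl with injective play n∈ n′∈ | o | o′
    ... | refl | inj₁ refl | inj₁ refl = refl
    ... | refl | inj₁ refl | inj₂ refl = ⊥-elim (edges-asym e∈ e′∈)
    ... | refl | inj₂ refl | inj₁ refl = ⊥-elim (edges-asym e∈ e′∈)
    ... | refl | inj₂ refl | inj₂ refl = refl

    edge-injective : ∀ {e e′ k} → e ∈ edges → e′ ∈ edges →
      edgeLabel p′ e ≡ just k → edgeLabel p′ e′ ≡ just k → e ≡ e′
    edge-injective e∈ e′∈ eq eq′ with classify e∈ eq | classify e′∈ eq′
    ... | inj₁ new | inj₁ new′ = new-new e∈ e′∈ new new′
    ... | inj₁ new | inj₂ old  = ⊥-elim (new≢old e′∈ new old)
    ... | inj₂ old | inj₁ new  = ⊥-elim (new≢old e∈ new old)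
    ... | inj₂ old | inj₂ old′ = mapMaybe-unique⁻ (edgeLabel (pos s)) (play-unique play) e∈ e′∈ old old′

    legal : Legal (pos s) v (ℓ l)
    legal = record
      { free     = free⇒nothing s free
      ; inRange  = ℓ≤ l≤
      ; unused   = λ w eq → let i , w∈ , e = pos⇒∈ s eq in
          unused (subst (λ x → (w , x) ∈ s) (sym (ℓ-injective l≤ (bounded play w∈) e)) w∈)
      ; distinct = mapMaybe-unique⁺ (edgeLabel p′) edges-unique edge-injective
      }

  bob-turn : ∀ {s v l} → Play ((v , l) ∷ s) → BobWins alice (pos ((v , l) ∷ s)) → BobWins bob (pos s)
  bob-turn {s} play@((_ , leg) ∷ _) win = bobMove _ _ (¬complete {s} (head-free play)) leg win

  bob-dooms : ∀ {s v l} → Play ((v , l) ∷ s) → Doomed ((v , l) ∷ s) → BobWins bob (pos s)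
  bob-dooms play doom = bob-turn play (doomed⇒win play doom alice)

  extend-isolated : ∀ {s v l} → Play s → Free s v → l ≤ m → Unused s l → Neighbours s v [] → Play ((v , l) ∷ s)
  -- There is no neighbour to check, so the trivial bound, all labels up to `m`, serves for `E`.
  extend-isolated play free l≤ unused nbrs = extend play free l≤ unused {E = upTo (suc m)} nbrs
    (λ {_} {i} {_} {j} u∈ v∈ _ → ∈-upTo⁺ (s≤s (≤-trans (∣m-n∣≤m⊔n i j) (⊔-lub (bounded play u∈) (bounded play v∈)))))
    (λ ()) (λ ())

  extend-pendant : ∀ {s v l k E} → Play s → Free s v → l ≤ m → Unused s l →
    Neighbours s v (k ∷ []) → EdgeLabels s E → ∣ l - k ∣ ∉ E → Play ((v , l) ∷ s)
  extend-pendant play free l≤ unused nbrs elabs new∉ = extend play free l≤ unused nbrs elabs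
    (λ { (here refl) → new∉ }) (λ { (here refl) (here refl) _ → refl })

  edgeLabels-[] : EdgeLabels [] []
  edgeLabels-[] ()

  -- `none`, `skip` and `keep` build `N` move by move. `keep` asks for no adjacency, so it also
  -- covers moves of Alice whose adjacency to `v` is unknown.
  none : ∀ {v} → Neighbours [] v []
  none ()

  skip : ∀ {s v n k N} → ¬ Adj v n → Neighbours s v N → Neighbours ((n , k) ∷ s) v N
  skip ¬adj nbrs (here refl) adj = ⊥-elim (¬adj adj)
  skip ¬adj nbrs (there n∈)  adj = nbrs n∈ adj

  keep : ∀ {s v n k N} → Neighbours s v N → Neighbours ((n , k) ∷ s) v (k ∷ N)
  keep nbrs (here refl) adj = here refl
  keep nbrs (there n∈)  adj = there (nbrs n∈ adj)

  free-[] : ∀ {v} → Free [] v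
  free-[] ()

  free-∷ : ∀ {s u v l} → v ≢ u → Free s v → Free ((u , l) ∷ s) v
  free-∷ v≢u free (here refl) = v≢u refl
  free-∷ v≢u free (there v∈)  = free v∈

  unused-[] : ∀ {l} → Unused [] l
  unused-[] ()

  unused-∷ : ∀ {s u k l} → l ≢ k → Unused s l → Unused ((u , k) ∷ s) l
  unused-∷ l≢k unused (here refl) = l≢k refl
  unused-∷ l≢k unused (there v∈)  = unused v∈

  -- Where the labels m, m ∸ 1 and m ∸ 2 can occur.

  module _ {q : V → ℕ} (graceful : Graceful q) where
    open Graceful graceful

    -- The larger end is at most `m`, so the smaller is at most `d`. For `d` = 0, 1, 2 the next
    -- lemmas run through the values of the smaller end and recognise the vertices by injectivity of
    -- `q`.
    large-edge : ∀ {d} → d < m → ∃₂ λ u v → Adj u v × q u ≤ d × q v ≡ q u + (m ∸ d)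
    large-edge {d} d<m =
      let u , v , adj , eq = edge-label (m<n⇒0<n∸m d<m) (m∸n≤m m d)
      in u , v , adj , +-cancelʳ-≤ (m ∸ d) (q u) d (begin
           q u + (m ∸ d) ≡⟨ eq ⟨
           q v           ≤⟨ q-bounded v ⟩
           m             ≡⟨ m+[n∸m]≡n (<⇒≤ d<m) ⟨
           d + (m ∸ d)   ∎) , eq
      where open ≤-Reasoning

    edge-m : ∀ {a} → 0 < m → q a ≡ 0 → ∃ λ v → Adj a v × q v ≡ m
    edge-m 0<m qa with large-edge 0<m
    ... | u , v , adj , qu≤ , eq with q u in qu | qu≤
    ... | 0 | z≤n with q-injective (trans qu (sym qa))
    ... | refl = v , adj , eq

    edge-m∸1 : ∀ {a b} → 1 < m → q a ≡ 0 → q b ≡ m →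
      (∃ λ v → Adj a v × q v ≡ m ∸ 1) ⊎ (∃ λ v → Adj v b × q v ≡ 1)
    edge-m∸1 1<m qa qb with large-edge 1<m
    ... | u , v , adj , qu≤ , eq with q u in qu | qu≤
    ... | 0 | z≤n with q-injective (trans qu (sym qa))
    ... | refl = inj₁ (v , adj , eq)
    edge-m∸1 1<m qa qb | u , v , adj , qu≤ , eq | 1 | s≤s z≤n
      with q-injective (trans (trans eq (m+[n∸m]≡n (<⇒≤ 1<m))) (sym qb))
    ... | refl = inj₂ (u , adj , qu)

    edge-m∸2 : ∀ {a b c d} → 2 < m → q a ≡ 0 → q b ≡ m → q c ≡ 1 → q d ≡ m ∸ 1 →
      (∃ λ v → Adj a v × q v ≡ m ∸ 2) ⊎ (∃ λ v → Adj v b × q v ≡ 2) ⊎ Adj c d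
    edge-m∸2 2<m qa qb qc qd with large-edge 2<m
    ... | u , v , adj , qu≤ , eq with q u in qu | qu≤
    ... | 0 | z≤n with q-injective (trans qu (sym qa))
    ... | refl = inj₁ (v , adj , eq)
    edge-m∸2 2<m qa qb qc qd | u , v , adj , qu≤ , eq | 1 | s≤s z≤n
      with q-injective (trans qu (sym qc)) | q-injective (trans eq (trans (sym (+-∸-assoc 1 (<⇒≤ 2<m))) (sym qd)))
    ... | refl | refl = inj₂ (inj₂ adj)
    edge-m∸2 2<m qa qb qc qd | u , v , adj , qu≤ , eq | 2 | s≤s (s≤s z≤n)
      with q-injective (trans (trans eq (m+[n∸m]≡n (<⇒≤ 2<m))) (sym qb))
    ... | refl = inj₂ (inj₁ (u , adj , qu))

  doomed-apart : ∀ {s a b} → 0 < m → (a , 0) ∈ s → (b , m) ∈ s → ¬ Adj a b → Doomed s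
  doomed-apart 0<m a∈ b∈ ¬adj q ext graceful with edge-m graceful 0<m (ext a∈)
  ... | v , adj , qv with Graceful.q-injective graceful (trans qv (sym (ext b∈)))
  ... | refl = ¬adj adj

-- Prisms

iterate : ∀ {A : Set} → (A → A) → ℕ → A → A
iterate f zero    x = x
iterate f (suc d) x = f (iterate f d x)

iterate-suc : ∀ {A : Set} (f : A → A) d x → iterate f d (f x) ≡ iterate f (suc d) x
iterate-suc f zero    x = refl
iterate-suc f (suc d) x = cong f (iterate-suc f d x)

-- Arithmetic on the cycle.

module _ {k : ℕ} where
  private r = suc k

  -- On a cycle of length `suc k`, `k` steps forward amount to one step back.
  cycPrev : Fin r → Fin r
  cycPrev = iterate cycNext k

  toℕ-cycNext : (i : Fin r) → toℕ (cycNext i) ≡ suc (toℕ i) % r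
  toℕ-cycNext i = toℕ-fromℕ< _

  toℕ-iterate : ∀ d (i : Fin r) → toℕ (iterate cycNext d i) ≡ (d + toℕ i) % r
  toℕ-iterate zero    i = sym (m<n⇒m%n≡m (toℕ<n i))
  toℕ-iterate (suc d) i = begin
    toℕ (cycNext (iterate cycNext d i))       ≡⟨ toℕ-cycNext (iterate cycNext d i) ⟩
    suc (toℕ (iterate cycNext d i)) % r       ≡⟨ cong (λ t → suc t % r) (toℕ-iterate d i) ⟩
    (1 + (d + toℕ i) % r) % r                 ≡⟨ %-distribˡ-+ 1 ((d + toℕ i) % r) r ⟩
    (1 % r + (d + toℕ i) % r % r) % r         ≡⟨ cong (λ t → (1 % r + t) % r) (m%n%n≡m%n (d + toℕ i) r) ⟩
    (1 % r + (d + toℕ i) % r) % r             ≡⟨ %-distribˡ-+ 1 (d + toℕ i) r ⟨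
    suc (d + toℕ i) % r                       ∎
    where open ≡-Reasoning

  cycNext-cycPrev : (i : Fin r) → cycNext (cycPrev i) ≡ i
  cycNext-cycPrev i = toℕ-injective (begin
    toℕ (iterate cycNext r i) ≡⟨ toℕ-iterate r i ⟩
    (r + toℕ i) % r           ≡⟨ cong (_% r) (+-comm r (toℕ i)) ⟩
    (toℕ i + r) % r           ≡⟨ [m+n]%n≡m%n (toℕ i) r ⟩
    toℕ i % r                 ≡⟨ m<n⇒m%n≡m (toℕ<n i) ⟩
    toℕ i                     ∎)
    where open ≡-Reasoning

  cycNext-injective : {i j : Fin r} → cycNext i ≡ cycNext j → i ≡ j
  cycNext-injective {i} {j} eq = begin
    i                   ≡⟨ cycPrev-cycNext i ⟨
    cycPrev (cycNext i) ≡⟨ cong cycPrev eq ⟩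
    cycPrev (cycNext j) ≡⟨ cycPrev-cycNext j ⟩
    j                   ∎
    where
    open ≡-Reasoning
    cycPrev-cycNext : ∀ i → cycPrev (cycNext i) ≡ i
    cycPrev-cycNext i = trans (iterate-suc cycNext k i) (cycNext-cycPrev i)

  -- A return after `suc d` steps would make `suc d` a multiple of `r`, yet it lies strictly between
  -- 0 and `r`.
  iterate-cycNext≢ : ∀ {d} → d < k → (i : Fin r) → iterate cycNext (suc d) i ≢ i
  iterate-cycNext≢ {d} d<k i eq = multiple ((suc d + t) / r) (+-cancelˡ-≡ t _ _ (begin
      t + suc d                                 ≡⟨ +-comm t (suc d) ⟩
      suc d + t                                 ≡⟨ m≡m%n+[m/n]*n (suc d + t) r ⟩
      (suc d + t) % r + ((suc d + t) / r) * r   ≡⟨ cong (_+ ((suc d + t) / r) * r) (toℕ-iterate (suc d) i) ⟨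
      toℕ (iterate cycNext (suc d) i) + ((suc d + t) / r) * r ≡⟨ cong (λ j → toℕ j + ((suc d + t) / r) * r) eq ⟩
      t + ((suc d + t) / r) * r                 ∎))
    where
    open ≡-Reasoning
    t = toℕ i
    multiple : ∀ q → suc d ≢ q * r
    multiple (suc q) e = <-irrefl e (s≤s (≤-trans d<k (m≤m+n k _)))

private
  -- The anonymous list inside `prismEdges`, named so that `prismEdges r` is
  -- `concatMap row (allFin r)` by definition.
  row : ∀ {r} → Fin r → List ((Fin r × Fin 2) × (Fin r × Fin 2))
  row i = ((i , fzero)      , (cycNext i , fzero))
        ∷ ((i , fsuc fzero) , (cycNext i , fsuc fzero))
        ∷ ((i , fzero)      , (i , fsuc fzero))
        ∷ []

-- The edges of a prism.

data Edge {r} : (Fin r × Fin 2) × (Fin r × Fin 2) → Set where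
  along : ∀ i s → Edge ((i , s) , (cycNext i , s))
  rung  : ∀ i → Edge ((i , fzero) , (i , fsuc fzero))

-- The strategies see the edge list only through these properties: computing with prismEdges itself would be slow.
record IsPrismEdges (k : ℕ) (es : List ((Fin (3 + k) × Fin 2) × (Fin (3 + k) × Fin 2))) : Set where
  field
    es-unique : Unique es
    es-length : length es ≡ (3 + k) * 3
    ∈⇒Edge    : ∀ {e} → e ∈ es → Edge e
    Edge⇒∈    : ∀ {e} → Edge e → e ∈ es

module _ (k : ℕ) where
  private r = 3 + k

  cycNext≢ : (i : Fin r) → cycNext i ≢ i
  cycNext≢ = iterate-cycNext≢ (s≤s z≤n)

  cycNext²≢ : (i : Fin r) → cycNext (cycNext i) ≢ i
  cycNext²≢ = iterate-cycNext≢ (s≤s (s≤s z≤n))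

  isPrismEdges : IsPrismEdges k (prismEdges r)
  isPrismEdges = record
    { es-unique = Uniqueₚ.concat⁺ (Allₚ.map⁺ (All.tabulate (λ {i} _ → row-unique i)))
                    (AllPairsₚ.map⁺ (AllPairs.map rows-disjoint (Uniqueₚ.allFin⁺ r)))
    ; es-length = trans (len (allFin r)) (cong (_* 3) (length-tabulate {n = r} (λ i → i)))
    ; ∈⇒Edge    = edge⁻
    ; Edge⇒∈    = edge⁺
    }
    where
    row-unique : (i : Fin r) → Unique (row i)
    row-unique i = ((λ ()) ∷ (λ eq → cycNext≢ i (cong (proj₁ ∘ proj₂) eq)) ∷ [])
                 ∷ ((λ ()) ∷ []) ∷ [] ∷ []
    -- All edges listed for `i` start in column `i`; hence the lists of different columns are
    -- disjoint.
    start : ∀ {i e} → e ∈ row i → proj₁ (proj₁ e) ≡ i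
    start (here refl)                 = refl
    start (there (here refl))         = refl
    start (there (there (here refl))) = refl
    rows-disjoint : {i j : Fin r} → i ≢ j → ∀ {e} → ¬ (e ∈ row i × e ∈ row j)
    rows-disjoint i≢j (e∈ , e∈′) = i≢j (trans (sym (start e∈)) (start e∈′))
    len : ∀ is → length (concatMap (row {r}) is) ≡ length is * 3
    len []       = refl
    len (i ∷ is) = cong (3 +_) (len is)
    edge⁻ : ∀ {e} → e ∈ prismEdges r → Edge e
    edge⁻ e∈ with find (∈-concatMap⁻ row {xs = allFin r} e∈)
    ... | i , _ , here refl                 = along i fzero
    ... | i , _ , there (here refl)         = along i (fsuc fzero)
    ... | i , _ , there (there (here refl)) = rung i
    edge⁺ : ∀ {e} → Edge e → e ∈ prismEdges r
    edge⁺ (along i fzero)        = ∈-concatMap⁺ row (lose (∈-allFin i) (here refl))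
    edge⁺ (along i (fsuc fzero)) = ∈-concatMap⁺ row (lose (∈-allFin i) (there (here refl)))
    edge⁺ (rung i)               = ∈-concatMap⁺ row (lose (∈-allFin i) (there (there (here refl))))

flip : Fin 2 → Fin 2
flip fzero        = fsuc fzero
flip (fsuc fzero) = fzero

flip≢ : ∀ s → flip s ≢ s
flip≢ fzero        ()
flip≢ (fsuc fzero) ()

flip-unique : ∀ {s t} → s ≢ t → t ≡ flip s
flip-unique {fzero}      {fzero}      ne = ⊥-elim (ne refl)
flip-unique {fzero}      {fsuc fzero} ne = refl
flip-unique {fsuc fzero} {fzero}      ne = refl
flip-unique {fsuc fzero} {fsuc fzero} ne = ⊥-elim (ne refl)

-- The game on a prism.

module PrismGame (k : ℕ) (es : List ((Fin (3 + k) × Fin 2) × (Fin (3 + k) × Fin 2)))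
                 (isPrism : IsPrismEdges k es) (isometry : Isometry (length es)) where
  open IsPrismEdges isPrism

  private
    r = 3 + k

    graph : Graph
    graph = record { V = Fin r × Fin 2 ; _≟V_ = ≡-dec _≟ᶠ_ _≟ᶠ_ ; edges = es }

    graph-simple : Simple graph
    graph-simple = record
      { vertices     = cartesianProduct (allFin r) (allFin 2)
      ; ∈-vertices   = λ (i , s) → ∈-cartesianProduct⁺ (∈-allFin i) (∈-allFin s)
      ; edges-unique = es-unique
      ; edges-asym   = λ e∈ e∈′ → asym (∈⇒Edge e∈) (∈⇒Edge e∈′) refl refl
      }
      where
      -- The ends are linked by equations, because unification cannot invert `cycNext`. Two opposite
      -- edges along a cycle would mean a return after two steps, which r ≥ 3 forbids.
      asym : ∀ {u v u′ v′ : Fin r × Fin 2} → Edge (u , v) → Edge (v′ , u′) → u ≡ u′ → v ≢ v′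
      asym (along i s) (along j t) eq eq′ =
        cycNext²≢ k j (trans (cong cycNext (sym (cong proj₁ eq))) (cong proj₁ eq′))
      asym (along i s) (rung j)    eq eq′ with trans (sym (cong proj₂ eq)) (cong proj₂ eq′)
      ... | ()
      asym (rung i)    (along j t) eq eq′ with trans (cong proj₂ eq) (sym (cong proj₂ eq′))
      ... | ()

  open Game graph graph-simple isometry public

  adj-next : ∀ i s → Adj (i , s) (cycNext i , s)
  adj-next i s = inj₁ (Edge⇒∈ (along i s))

  adj-rung : ∀ i s → Adj (i , s) (i , flip s)
  adj-rung i fzero        = inj₁ (Edge⇒∈ (rung i))
  adj-rung i (fsuc fzero) = inj₂ (Edge⇒∈ (rung i))

  adj⁻ : ∀ {i j s t} → Adj (i , s) (j , t) → (i ≡ j × s ≢ t) ⊎ (s ≡ t × (j ≡ cycNext i ⊎ i ≡ cycNext j))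
  adj⁻ (inj₁ e) with ∈⇒Edge e
  ... | along _ _ = inj₂ (refl , inj₁ refl)
  ... | rung _    = inj₁ (refl , λ ())
  adj⁻ (inj₂ e) with ∈⇒Edge e
  ... | along _ _ = inj₂ (refl , inj₂ refl)
  ... | rung _    = inj₁ (refl , λ ())

  neighbours : ∀ {i s v} → Adj (i , s) v → v ≡ (i , flip s) ⊎ v ≡ (cycNext i , s) ⊎ v ≡ (cycPrev i , s)
  neighbours {i} {s} adj with adj⁻ adj
  ... | inj₁ (refl , s≢t)         = inj₁ (cong (i ,_) (flip-unique s≢t))
  ... | inj₂ (refl , inj₁ refl)   = inj₂ (inj₁ refl)
  ... | inj₂ (refl , inj₂ i≡)     =
    inj₂ (inj₂ (cong (_, s) (cycNext-injective (trans (sym i≡) (sym (cycNext-cycPrev i))))))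

  ¬adj-skew : ∀ {i j s t} → i ≢ j → s ≢ t → ¬ Adj (i , s) (j , t)
  ¬adj-skew i≢j s≢t adj with adj⁻ adj
  ... | inj₁ (i≡j , _) = i≢j i≡j
  ... | inj₂ (s≡t , _) = s≢t s≡t

  ¬adj-row : ∀ {i j s} → j ≢ cycNext i → i ≢ cycNext j → ¬ Adj (i , s) (j , s)
  ¬adj-row j≢ i≢ adj with adj⁻ adj
  ... | inj₁ (_ , s≢s)     = s≢s refl
  ... | inj₂ (_ , inj₁ j≡) = j≢ j≡
  ... | inj₂ (_ , inj₂ i≡) = i≢ i≡

-- Bob's strategies for r ≥ 4

module LargePrism (n : ℕ) (es : List ((Fin (4 + n) × Fin 2) × (Fin (4 + n) × Fin 2)))
                  (isPrism : IsPrismEdges (suc n) es) (isometry : Isometry (length es)) where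
  open PrismGame (suc n) es isPrism isometry public

  12≤m : 12 ≤ m
  12≤m = ≤-trans (m≤m+n 12 (n * 3)) (≤-reflexive (sym (IsPrismEdges.es-length isPrism)))

  <m : ∀ {d} → d < 12 → d < m
  <m d<12 = ≤-trans d<12 12≤m

  0<m : 0 < m
  0<m = <m (s≤s z≤n)

  1<m : 1 < m
  1<m = <m (s≤s (s≤s z≤n))

  2<m : 2 < m
  2<m = <m (s≤s (s≤s (s≤s z≤n)))

  ≢m∸ : ∀ {d e} → d + e < m → d ≢ m ∸ e
  ≢m∸ {d} {e} lt refl = <⇒≱ lt (≤-trans (m≤n+m∸n m e) (≤-reflexive (+-comm e (m ∸ e))))

  module _ (i : Fin (4 + n)) where
    next≢ : cycNext i ≢ i
    next≢ = iterate-cycNext≢ (s≤s z≤n) i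

    next²≢ : cycNext (cycNext i) ≢ i
    next²≢ = iterate-cycNext≢ (s≤s (s≤s z≤n)) i

    -- Here r ≥ 4 enters: on a triangle three steps lead back to the start.
    next³≢ : cycNext (cycNext (cycNext i)) ≢ i
    next³≢ = iterate-cycNext≢ (s≤s (s≤s (s≤s z≤n))) i

    prev≢ : cycPrev i ≢ i
    prev≢ eq = next≢ (trans (cong cycNext (sym eq)) (cycNext-cycPrev i))

    prev≢next : cycPrev i ≢ cycNext i
    prev≢next eq = next²≢ (trans (cong cycNext (sym eq)) (cycNext-cycPrev i))

    prev≢next² : cycPrev i ≢ cycNext (cycNext i)
    prev≢next² eq = next³≢ (trans (cong cycNext (sym eq)) (cycNext-cycPrev i))

  ¬Adj-sym : ∀ {u v} → ¬ Adj u v → ¬ Adj v u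
  ¬Adj-sym ¬adj adj = ¬adj (Adj-sym adj)

  -- Columns are the rungs, rows the two copies of the cycle.
  col≢ : {i j : Fin (4 + n)} {s t : Fin 2} → i ≢ j → (i , s) ≢ (j , t)
  col≢ i≢j eq = i≢j (cong proj₁ eq)

  row≢ : {i j : Fin (4 + n)} {s t : Fin 2} → s ≢ t → (i , s) ≢ (j , t)
  row≢ s≢t eq = s≢t (cong proj₂ eq)

  -- Only y° can take the label m, and then neither 0 nor m is an end of an edge labelled m ∸ 1.
  doomed-third : ∀ {t w a y y° x j} →
    (∀ {v} → Adj a v → v ≡ w ⊎ v ≡ y ⊎ v ≡ y°) → ¬ Adj w y° → ¬ Adj y y° →
    (w , x) ∈ t → (a , 0) ∈ t → (y , j) ∈ t →
    x ≢ m → x ≢ m ∸ 1 → j ≢ m → j ≢ m ∸ 1 → x ≡ 1 ⊎ j ≡ 1 → Doomed t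
  doomed-third {w = w} {y = y} {y° = y°} nbrs w≁y° y≁y° w∈ a∈ y∈ x≢m x≢m∸1 j≢m j≢m∸1 x∨j q ext graceful
    with edge-m graceful 0<m (ext a∈)
  ... | v , adj , qv with nbrs adj
  ... | inj₁ refl        = x≢m (trans (sym (ext w∈)) qv)
  ... | inj₂ (inj₁ refl) = j≢m (trans (sym (ext y∈)) qv)
  ... | inj₂ (inj₂ refl) with edge-m∸1 graceful 1<m (ext a∈) qv
  ... | inj₁ (v′ , adj′ , qv′) = case (nbrs adj′)
    where
    case : v′ ≡ w ⊎ v′ ≡ y ⊎ v′ ≡ y° → ⊥
    case (inj₁ refl)        = x≢m∸1 (trans (sym (ext w∈)) qv′)
    case (inj₂ (inj₁ refl)) = j≢m∸1 (trans (sym (ext y∈)) qv′)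
    case (inj₂ (inj₂ refl)) = <⇒≢ (∸-monoʳ-< (s≤s z≤n) 0<m) (trans (sym qv′) qv)
  ... | inj₂ (v′ , adj′ , qv′) = case x∨j
    where
    open Graceful graceful
    case : _ ⊎ _ → ⊥
    case (inj₁ x≡1) = w≁y° (subst (λ u → Adj u y°) (q-injective (trans qv′ (sym (trans (ext w∈) x≡1)))) adj′)
    case (inj₂ j≡1) = y≁y° (subst (λ u → Adj u y°) (q-injective (trans qv′ (sym (trans (ext y∈) j≡1)))) adj′)

  -- Alice opens.

  module AliceFirst (i : Fin (4 + n)) {s s′ : Fin 2} (s≢s′ : s ≢ s′)
                    {x : ℕ} (x≢0 : x ≢ 0) (x≢m : x ≢ m) (x≢m∸1 : x ≢ m ∸ 1) where
    private
      s′≢s : s′ ≢ s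
      s′≢s = s≢s′ ∘ sym
      i₁ i₂ i₃ i₋ : Fin (4 + n)
      i₁ = cycNext i
      i₂ = cycNext i₁
      i₃ = cycNext i₂
      i₋ = cycPrev i
      -- `w` carries Alice's `x`; Bob's 0 goes to `a`, the other end of its rung, whose remaining
      -- neighbours are `y₁` and `y₂`.
      w a y₁ y₂ : V
      w  = i  , s
      a  = i  , s′
      y₁ = i₁ , s′
      y₂ = i₋ , s′
      t₁ t₂ : Moves
      t₁ = (w , x) ∷ []
      t₂ = (a , 0) ∷ t₁

      a-nbrs : ∀ {v} → Adj a v → v ≡ w ⊎ v ≡ y₁ ⊎ v ≡ y₂
      a-nbrs adj with neighbours adj
      ... | inj₁ eq = inj₁ (trans eq (cong (i ,_) (sym (flip-unique s′≢s))))
      ... | inj₂ eq = inj₂ eq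

      y₁≁y₂ : ¬ Adj y₁ y₂
      y₁≁y₂ = ¬adj-row (prev≢next² i) (λ eq → next≢ i (trans eq (cycNext-cycPrev i)))
      w≁y₁ : ¬ Adj w y₁
      w≁y₁ = ¬adj-skew (next≢ i ∘ sym) s≢s′
      w≁y₂ : ¬ Adj w y₂
      w≁y₂ = ¬adj-skew (prev≢ i ∘ sym) s≢s′

      -- `j` is the label Bob may put on a neighbour of `a`. The bound on `j + 1` keeps it off both
      -- `m` and `m ∸ 1`; the last condition is for `elsewhere`, where it separates `j` from Alice's
      -- `z`.
      small : ∃ λ j → j ≢ x × 0 < j × j + 1 < m × (x ≡ 1 ⊎ j ≡ 1) × ∣ m - j ∣ ≢ x
      small with x ≟ 1
      ... | yes refl = 2 , (λ ()) , s≤s z≤n , <m (s≤s (s≤s (s≤s (s≤s z≤n)))) , inj₁ refl ,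
                       λ eq → ≢m∸ {1} {2} (<m (s≤s (s≤s (s≤s (s≤s z≤n)))))
                         (trans (sym eq) (m≤n⇒∣n-m∣≡n∸m (<⇒≤ 2<m)))
      ... | no x≢1   = 1 , x≢1 ∘ sym , s≤s z≤n , 2<m , inj₂ refl ,
                       λ eq → x≢m∸1 (trans (sym eq) (m≤n⇒∣n-m∣≡n∸m (<⇒≤ 1<m)))

      open Σ small renaming (proj₁ to j; proj₂ to j-props)

      j≢x : j ≢ x
      j≢x = proj₁ j-props
      0<j : 0 < j
      0<j = proj₁ (proj₂ j-props)
      j+1<m : j + 1 < m
      j+1<m = proj₁ (proj₂ (proj₂ j-props))
      x∨j : x ≡ 1 ⊎ j ≡ 1
      x∨j = proj₁ (proj₂ (proj₂ (proj₂ j-props)))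
      j≢m∸x : ∣ m - j ∣ ≢ x
      j≢m∸x = proj₂ (proj₂ (proj₂ (proj₂ j-props)))
      j<m : j < m
      j<m = ≤-trans (s≤s (m≤m+n j 1)) j+1<m

      doomed-by-j : ∀ {t y y°} → (∀ {v} → Adj a v → v ≡ w ⊎ v ≡ y ⊎ v ≡ y°) →
        ¬ Adj w y° → ¬ Adj y y° → (w , x) ∈ t → (a , 0) ∈ t → (y , j) ∈ t → Doomed t
      doomed-by-j nbrs w≁y° y≁y° w∈ a∈ y∈ =
        doomed-third nbrs w≁y° y≁y° w∈ a∈ y∈ x≢m x≢m∸1 (<⇒≢ j<m) (≢m∸ j+1<m) x∨j

      -- Alice has labelled one of `y₁` and `y₂`, here called `y°`, and Bob puts `j` on the other.
      -- If she used `j` herself, the position is doomed already, with the two exchanged.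
      at-neighbour : ∀ {y y° z} → (∀ {v} → Adj a v → v ≡ w ⊎ v ≡ y ⊎ v ≡ y°) →
        ¬ Adj w y → ¬ Adj w y° → ¬ Adj y y° → y ≢ y° → y ≢ a → y ≢ w →
        Play ((y° , z) ∷ t₂) → BobWins bob (pos ((y° , z) ∷ t₂))
      at-neighbour {y} {y°} {z} nbrs w≁y w≁y° y≁y° y≢y° y≢a y≢w play with z ≟ j
      ... | yes refl = doomed⇒win play
        (doomed-by-j (Sum.map₂ Sum.swap ∘ nbrs) w≁y (¬Adj-sym y≁y°) (there (there (here refl))) (there (here refl)) (here refl)) bob
      ... | no z≢j = bob-dooms
        (extend-pendant play (free-∷ y≢y° (free-∷ y≢a (free-∷ y≢w free-[]))) (<⇒≤ j<m)
          (unused-∷ (z≢j ∘ sym) (unused-∷ (>⇒≢ 0<j) (unused-∷ j≢x unused-[])))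
          (skip y≁y° (keep (skip (¬Adj-sym w≁y) none)))
          (edgeLabels-∷ (edgeLabels-∷ (edgeLabels-∷ edgeLabels-[] none) (keep none))
            (keep (skip (¬Adj-sym w≁y°) none)))
          new∉)
        (doomed-by-j nbrs w≁y° y≁y° (there (there (there (here refl)))) (there (there (here refl))) (here refl))
        where
        new∉ : ∣ j - 0 ∣ ∉ ∣ z - 0 ∣ ∷ x ∷ []
        new∉ (here eq)         = z≢j (trans (sym (∣-∣-identityʳ z)) (trans (sym eq) (∣-∣-identityʳ j)))
        new∉ (there (here eq)) = j≢x (trans (sym (∣-∣-identityʳ j)) eq)

    module _ {v : V} {z : ℕ} (play : Play ((v , z) ∷ t₂)) (v≢y₁ : v ≢ y₁) (v≢y₂ : v ≢ y₂) where
      private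
        t₃ : Moves
        t₃ = (v , z) ∷ t₂
        z≤m : z ≤ m
        z≤m = bounded play (here refl)
        z≢x : z ≢ x
        z≢x refl = head-unused play (there (here refl))
        v≢w : v ≢ w
        v≢w refl = head-free play (there (here refl))
        v≁a : ¬ Adj v a
        v≁a adj with a-nbrs (Adj-sym adj)
        ... | inj₁ eq        = v≢w eq
        ... | inj₂ (inj₁ eq) = v≢y₁ eq
        ... | inj₂ (inj₂ eq) = v≢y₂ eq

        elabs : ¬ Adj v w → EdgeLabels t₃ (x ∷ [])
        elabs v≁w = edgeLabels-∷ {N = []} (edgeLabels-∷ (edgeLabels-∷ edgeLabels-[] none) (keep none))
          (skip v≁a (skip v≁w none))

        m-unused : z ≢ m → Unused t₃ m
        m-unused z≢m = unused-∷ (z≢m ∘ sym) (unused-∷ (>⇒≢ 0<m) (unused-∷ (x≢m ∘ sym) unused-[]))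

        m-at : ∀ {u} → ¬ Adj a u → Play ((u , m) ∷ t₃) → BobWins bob (pos t₃)
        m-at a≁u play′ = bob-dooms play′ (doomed-apart 0<m (there (there (here refl))) (here refl) a≁u)

        ∉-singleton : ∀ {k} → k ≢ x → k ∉ x ∷ []
        ∉-singleton k≢x (here eq) = k≢x eq

        a≁i₁ : ¬ Adj a (i₁ , s)
        a≁i₁ = ¬adj-skew (next≢ i ∘ sym) s′≢s
        a≁i₂ : ¬ Adj a (i₂ , s)
        a≁i₂ = ¬adj-skew (next²≢ i ∘ sym) s′≢s
        a≁i₂′ : ¬ Adj a (i₂ , s′)
        a≁i₂′ = ¬adj-row (next≢ i₁) (next³≢ i ∘ sym)
        w≁i₂ : ¬ Adj w (i₂ , s)
        w≁i₂ = ¬adj-row (next≢ i₁) (next³≢ i ∘ sym)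
        w≁i₂′ : ¬ Adj w (i₂ , s′)
        w≁i₂′ = ¬adj-skew (next²≢ i ∘ sym) s≢s′

        -- On `(i₁ , s)` the only labelled neighbour is `w`, so `m` is barred only if m - x = x. It
        -- then goes to `(i₂ , s)`, where at most `v` is a labelled neighbour, and a clash m - z = x
        -- would force z = x.
        opposite-row : z ≢ m → ¬ Adj v w → v ≢ (i₁ , s) → ¬ Adj v (i₁ , s) → v ≢ (i₂ , s) → BobWins bob (pos t₃)
        opposite-row z≢m v≁w v≢i₁ v≁i₁ v≢i₂ with ∣ m - x ∣ ≟ x
        ... | no m∸x≢x = m-at a≁i₁ (extend-pendant play
            (free-∷ (v≢i₁ ∘ sym) (free-∷ (row≢ s≢s′) (free-∷ (col≢ (next≢ i)) free-[]))) ≤-refl (m-unused z≢m)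
            (skip (¬Adj-sym v≁i₁) (skip (¬Adj-sym a≁i₁) (keep none))) (elabs v≁w) (∉-singleton m∸x≢x))
        ... | yes m∸x≡x = m-at a≁i₂ (extend-pendant play
            (free-∷ (v≢i₂ ∘ sym) (free-∷ (row≢ s≢s′) (free-∷ (col≢ (next²≢ i)) free-[]))) ≤-refl (m-unused z≢m)
            (keep (skip (¬Adj-sym a≁i₂) (skip (¬Adj-sym w≁i₂) none))) (elabs v≁w)
            (∉-singleton λ m∸z≡x → z≢x (∸-cancelˡ-≡ z≤m x≤m (begin
               m ∸ z     ≡⟨ m≤n⇒∣n-m∣≡n∸m z≤m ⟨
               ∣ m - z ∣ ≡⟨ trans m∸z≡x (sym m∸x≡x) ⟩
               ∣ m - x ∣ ≡⟨ m≤n⇒∣n-m∣≡n∸m x≤m ⟩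
               m ∸ x     ∎))))
          where
          open ≡-Reasoning
          x≤m : x ≤ m
          x≤m = bounded play (there (there (here refl)))

      -- Bob wants `m` on a vertex not adjacent to `a`, by preference `(i₂ , s′)`. Its only
      -- neighbours that Alice may have labelled are `(i₃ , s′)` and `(i₂ , s)`. If she took the
      -- former or the vertex itself, the other row serves; if the latter, one clash has to be
      -- watched.
      elsewhere : BobWins bob (pos t₃)
      elsewhere with z ≟ m
      ... | yes refl = doomed⇒win play (doomed-apart 0<m (there (here refl)) (here refl) (¬Adj-sym v≁a)) bob
      ... | no z≢m with v ≟V (i₂ , s′)
      ... | yes refl = opposite-row z≢m (¬Adj-sym w≁i₂′) (row≢ s′≢s) (¬adj-skew (next≢ i₁) s′≢s) (row≢ s′≢s)
      ... | no v≢i₂′ with v ≟V (i₃ , s′)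
      ... | yes refl = opposite-row z≢m (¬adj-skew (next³≢ i) s′≢s) (row≢ s′≢s) (¬adj-skew (next²≢ i₁) s′≢s) (row≢ s′≢s)
      ... | no v≢i₃′ with v ≟V (i₂ , s)
      ... | no v≢i₂ = m-at a≁i₂′ (extend-isolated play
          (free-∷ (v≢i₂′ ∘ sym) (free-∷ (col≢ (next²≢ i)) (free-∷ (col≢ (next²≢ i)) free-[]))) ≤-refl (m-unused z≢m)
          (skip v≁ (skip (¬Adj-sym a≁i₂′) (skip (¬Adj-sym w≁i₂′) none))))
        where
        v≁ : ¬ Adj (i₂ , s′) v
        v≁ adj with neighbours adj
        ... | inj₁ eq        = v≢i₂ (trans eq (cong (i₂ ,_) (sym (flip-unique s′≢s))))
        ... | inj₂ (inj₁ eq) = v≢i₃′ eq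
        ... | inj₂ (inj₂ eq) = v≢y₁ (trans eq (cong (_, s′) (cycNext-injective (cycNext-cycPrev i₂))))
      ... | yes refl with ∣ m - z ∣ ≟ x
      ... | no m∸z≢x = m-at a≁i₂′ (extend-pendant play
          (free-∷ (v≢i₂′ ∘ sym) (free-∷ (col≢ (next²≢ i)) (free-∷ (col≢ (next²≢ i)) free-[]))) ≤-refl (m-unused z≢m)
          (keep (skip (¬Adj-sym a≁i₂′) (skip (¬Adj-sym w≁i₂′) none))) (elabs (¬Adj-sym w≁i₂)) (∉-singleton m∸z≢x))
      -- m - z = x bars `m` from this vertex, so Bob puts `j` on `y₁` instead; `j` is not `z`, as m
      -- - j differs from `x`.
      ... | yes m∸z≡x = bob-dooms (extend-pendant play
          (free-∷ (row≢ s′≢s) (free-∷ (col≢ (next≢ i)) (free-∷ (row≢ s′≢s) free-[]))) (<⇒≤ j<m)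
          (unused-∷ (λ { refl → j≢m∸x m∸z≡x }) (unused-∷ (>⇒≢ 0<j) (unused-∷ j≢x unused-[])))
          (skip (¬adj-skew (next≢ i₁ ∘ sym) s′≢s) (keep (skip (¬Adj-sym w≁y₁) none))) (elabs (¬Adj-sym w≁i₂))
          (∉-singleton λ eq → j≢x (trans (sym (∣-∣-identityʳ j)) eq)))
        (doomed-by-j a-nbrs w≁y₂ y₁≁y₂ (there (there (there (here refl)))) (there (there (here refl))) (here refl))

    bob-wins : Play t₁ → BobWins bob (pos t₁)
    bob-wins play₁ = bob-turn play₂ (alice-turn play₂ (¬complete {t₂} {y₁} y₁-free) reply)
      where
      y₁-free : Free t₂ y₁
      y₁-free = free-∷ (col≢ (next≢ i)) (free-∷ (row≢ s′≢s) free-[])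
      play₂ : Play t₂
      play₂ = extend-pendant play₁ (free-∷ (row≢ s′≢s) free-[]) z≤n (unused-∷ (x≢0 ∘ sym) unused-[])
        (keep none) (edgeLabels-∷ edgeLabels-[] none) (λ ())
      reply : ∀ {v z} → Play ((v , z) ∷ t₂) → BobWins bob (pos ((v , z) ∷ t₂))
      reply {v} play with v ≟V y₁
      ... | yes refl = at-neighbour (Sum.map₂ Sum.swap ∘ a-nbrs) w≁y₂ w≁y₁ (¬Adj-sym y₁≁y₂)
                         (col≢ (prev≢next i)) (col≢ (prev≢ i)) (row≢ s′≢s) play
      ... | no v≢y₁ with v ≟V y₂
      ... | yes refl = at-neighbour a-nbrs w≁y₁ w≁y₂ y₁≁y₂
                         (col≢ (prev≢next i ∘ sym)) (col≢ (next≢ i)) (row≢ s′≢s) play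
      ... | no v≢y₂ = elsewhere play v≢y₁ v≢y₂

  -- If Alice opened with 0, Bob at once puts `m` in another column and the other row, away from it.
  -- The excluded openings `m` and `m ∸ 1` become 0 and 1 under the complement.
  reply-to-first : ∀ {v x} → Play ((v , x) ∷ []) → x ≢ m → x ≢ m ∸ 1 → BobWins bob (pos ((v , x) ∷ []))
  reply-to-first {i , s} {x} play x≢m x≢m∸1 with x ≟ 0
  ... | no x≢0   = AliceFirst.bob-wins i (flip≢ s ∘ sym) x≢0 x≢m x≢m∸1 play
  ... | yes refl = bob-dooms
    (extend-isolated play (free-∷ (row≢ (flip≢ s)) free-[]) ≤-refl (unused-∷ (>⇒≢ 0<m) unused-[])
      (skip (¬Adj-sym apart) none))
    (doomed-apart 0<m (there (here refl)) (here refl) apart)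
    where
    apart : ¬ Adj (i , s) (cycNext i , flip s)
    apart = ¬adj-skew (next≢ i ∘ sym) (flip≢ s ∘ sym)

  -- Bob opens.

  spoiler : ∀ {z} → 0 < z → z ≤ m → ∃ λ j → j < m × j ∉ 0 ∷ 1 ∷ m ∷ m ∸ 1 ∷ z ∷ [] ×
    j ∉ ∣ z - 1 ∣ ∷ ∣ z - m ∣ ∷ 1 ∷ m ∷ [] × ∣ j - z ∣ ∉ ∣ z - 1 ∣ ∷ ∣ z - m ∣ ∷ 1 ∷ m ∷ [] × ∣ j - z ∣ ≢ j
  -- `j` is meant for the last free neighbour of 0, perhaps next to `z`. The list holds the labels
  -- in use, `m ∸ 1`, the edge labels, and those `j` for which ∣ j - z ∣ is an edge label or `j`
  -- itself. Coincidences keep it at 11 entries: z - (z - 1) is 1, z + (m - z) is `m`, and z - 1 is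
  -- ∣ z - 1 ∣.
  spoiler {z} 0<z z≤m with fresh (0 ∷ 1 ∷ m ∷ m ∸ 1 ∷ z ∷ ∣ z - 1 ∣ ∷ ∣ z - m ∣ ∷ suc z ∷
                                  z ∸ ∣ z - m ∣ ∷ z + ∣ z - 1 ∣ ∷ ⌊ z /2⌋ ∷ [])
  ... | j , j≤11 , j∉ = j , j<m , used , j∉E , ∣j-z∣∉E , ∣j-z∣≢j
    where
    j<m : j < m
    j<m = ≤-trans (s≤s j≤11) 12≤m
    j≢0 : j ≢ 0
    j≢0 = j∉ ∘ here
    j≢1 : j ≢ 1
    j≢1 = j∉ ∘ there ∘ here
    j≢m : j ≢ m
    j≢m = <⇒≢ j<m
    j≢∣z-1∣ : j ≢ ∣ z - 1 ∣
    j≢∣z-1∣ = j∉ ∘ there ∘ there ∘ there ∘ there ∘ there ∘ here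
    j≢∣z-m∣ : j ≢ ∣ z - m ∣
    j≢∣z-m∣ = j∉ ∘ there ∘ there ∘ there ∘ there ∘ there ∘ there ∘ here
    j≢1+z : j ≢ suc z
    j≢1+z = j∉ ∘ there ∘ there ∘ there ∘ there ∘ there ∘ there ∘ there ∘ here
    j≢z∸∣z-m∣ : j ≢ z ∸ ∣ z - m ∣
    j≢z∸∣z-m∣ = j∉ ∘ there ∘ there ∘ there ∘ there ∘ there ∘ there ∘ there ∘ there ∘ here
    j≢z+∣z-1∣ : j ≢ z + ∣ z - 1 ∣
    j≢z+∣z-1∣ = j∉ ∘ there ∘ there ∘ there ∘ there ∘ there ∘ there ∘ there ∘ there ∘ there ∘ here
    j≢⌊z/2⌋ : j ≢ ⌊ z /2⌋
    j≢⌊z/2⌋ = j∉ ∘ there ∘ there ∘ there ∘ there ∘ there ∘ there ∘ there ∘ there ∘ there ∘ there ∘ here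

    ∣z-1∣≡z∸1 : ∣ z - 1 ∣ ≡ z ∸ 1
    ∣z-1∣≡z∸1 = m≤n⇒∣n-m∣≡n∸m 0<z

    used : j ∉ 0 ∷ 1 ∷ m ∷ m ∸ 1 ∷ z ∷ []
    used (here e)                                 = j≢0 e
    used (there (here e))                         = j≢1 e
    used (there (there (here e)))                 = j≢m e
    used (there (there (there (here e))))         = j∉ (there (there (there (here e))))
    used (there (there (there (there (here e))))) = j∉ (there (there (there (there (here e)))))

    j∉E : j ∉ ∣ z - 1 ∣ ∷ ∣ z - m ∣ ∷ 1 ∷ m ∷ []
    j∉E (here e)                         = j≢∣z-1∣ e
    j∉E (there (here e))                 = j≢∣z-m∣ e
    j∉E (there (there (here e)))         = j≢1 e
    j∉E (there (there (there (here e)))) = j≢m e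

    ∣j-z∣∉E : ∣ j - z ∣ ∉ ∣ z - 1 ∣ ∷ ∣ z - m ∣ ∷ 1 ∷ m ∷ []
    ∣j-z∣∉E (here e) with ∣-∣≡⇒+ j z e
    ... | inj₁ j≡ = j≢z+∣z-1∣ j≡
    ... | inj₂ z≡ = j≢1 (+-cancelʳ-≡ (z ∸ 1) j 1 (begin
      j + (z ∸ 1)   ≡⟨ cong (j +_) ∣z-1∣≡z∸1 ⟨
      j + ∣ z - 1 ∣ ≡⟨ z≡ ⟨
      z             ≡⟨ m+[n∸m]≡n 0<z ⟨
      1 + (z ∸ 1)   ∎))
      where open ≡-Reasoning
    ∣j-z∣∉E (there (here e)) with ∣-∣≡⇒+ j z e
    ... | inj₁ j≡ = j≢m (trans j≡ (trans (cong (z +_) (m≤n⇒∣m-n∣≡n∸m z≤m)) (m+[n∸m]≡n z≤m)))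
    ... | inj₂ z≡ = j≢z∸∣z-m∣ (trans (sym (m+n∸n≡m j ∣ z - m ∣)) (cong (_∸ ∣ z - m ∣) (sym z≡)))
    ∣j-z∣∉E (there (there (here e))) with ∣-∣≡⇒+ j z e
    ... | inj₁ j≡ = j≢1+z (trans j≡ (+-comm z 1))
    ... | inj₂ z≡ = j≢∣z-1∣ (trans (sym (m+n∸n≡m j 1)) (trans (cong (_∸ 1) (sym z≡)) (sym ∣z-1∣≡z∸1)))
    ∣j-z∣∉E (there (there (there (here e)))) with ∣-∣≡⇒+ j z e
    ... | inj₁ j≡ = <⇒≱ j<m (≤-trans (m≤n+m m z) (≤-reflexive (sym j≡)))
    ... | inj₂ z≡ = j≢0 (n≤0⇒n≡0 (+-cancelʳ-≤ m j 0 (≤-trans (≤-reflexive (sym z≡)) z≤m)))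

    ∣j-z∣≢j : ∣ j - z ∣ ≢ j
    ∣j-z∣≢j e with ∣-∣≡⇒+ j z e
    ... | inj₁ j≡ = <⇒≢ 0<z (sym (+-cancelʳ-≡ j z 0 (sym j≡)))
    ... | inj₂ z≡ = j≢⌊z/2⌋ (trans (n≡⌊n+n/2⌋ j) (cong ⌊_/2⌋ (sym z≡)))

  module BobFirst (i : Fin (4 + n)) {s s′ : Fin 2} (s≢s′ : s ≢ s′) where
    private
      s′≢s : s′ ≢ s
      s′≢s = s≢s′ ∘ sym
      i₁ i₂ i₋ : Fin (4 + n)
      i₁ = cycNext i
      i₂ = cycNext i₁
      i₋ = cycPrev i
      -- `u` is two columns away in the other row: adjacent neither to `a` nor to a neighbour of
      -- `a`.
      a u n₁ n₂ n₃ : V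
      a  = i  , s
      u  = i₂ , s′
      n₁ = i  , s′
      n₂ = i₁ , s
      n₃ = i₋ , s
      t₁ : Moves
      t₁ = (a , 0) ∷ []

      a-nbrs : ∀ {v} → Adj a v → v ≡ n₁ ⊎ v ≡ n₂ ⊎ v ≡ n₃
      a-nbrs adj with neighbours adj
      ... | inj₁ eq = inj₁ (trans eq (cong (i ,_) (sym (flip-unique s≢s′))))
      ... | inj₂ eq = inj₂ eq

      a≁u : ¬ Adj a u
      a≁u = ¬adj-skew (next²≢ i ∘ sym) s≢s′
      n₁≁u : ¬ Adj n₁ u
      n₁≁u = ¬adj-row (next≢ i₁) (next³≢ i ∘ sym)
      n₂≁u : ¬ Adj n₂ u
      n₂≁u = ¬adj-skew (next≢ i₁ ∘ sym) s≢s′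
      n₃≁u : ¬ Adj n₃ u
      n₃≁u = ¬adj-skew (prev≢next² i) s≢s′
      n₁≁n₂ : ¬ Adj n₁ n₂
      n₁≁n₂ = ¬adj-skew (next≢ i ∘ sym) s′≢s
      n₁≁n₃ : ¬ Adj n₁ n₃
      n₁≁n₃ = ¬adj-skew (prev≢ i ∘ sym) s′≢s
      n₂≁n₃ : ¬ Adj n₂ n₃
      n₂≁n₃ = ¬adj-row (prev≢next² i) (λ eq → next≢ i (trans eq (cycNext-cycPrev i)))

      -- The neighbours of 0 by role: `b` has Alice's `m`, `y` gets Bob's 1, `y′` is left over. The
      -- module is applied once for each choice of `b`.
      module Endgame {b y y′ : V} (nbrs : ∀ {v} → Adj a v → v ≡ y ⊎ v ≡ y′ ⊎ v ≡ b)
                     (y≢b : y ≢ b) (y≢y′ : y ≢ y′) (y′≢b : y′ ≢ b) (y≢a : y ≢ a) (y′≢a : y′ ≢ a)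
                     (y≁b : ¬ Adj y b) (y≁y′ : ¬ Adj y y′) (y′≁b : ¬ Adj y′ b)
                     (u≢b : u ≢ b) (u≢y : u ≢ y) (u≢y′ : u ≢ y′)
                     (b≁u : ¬ Adj b u) (y≁u : ¬ Adj y u) (y′≁u : ¬ Adj y′ u) where
        t₂ t₃ : Moves
        t₂ = (b , m) ∷ t₁
        t₃ = (y , 1) ∷ t₂

        elabs₂ : EdgeLabels t₂ (∣ m - 0 ∣ ∷ [])
        elabs₂ = edgeLabels-∷ (edgeLabels-∷ edgeLabels-[] none) (keep none)

        elabs₃ : EdgeLabels t₃ (1 ∷ ∣ m - 0 ∣ ∷ [])
        elabs₃ = edgeLabels-∷ elabs₂ (skip y≁b (keep none))

        doomed-filled : ∀ {t j} → (a , 0) ∈ t → (y , 1) ∈ t → (y′ , j) ∈ t → j ≢ m → j ≢ m ∸ 1 → Doomed t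
        doomed-filled a∈ y∈ y′∈ j≢m j≢m∸1 =
          doomed-third nbrs y≁b y′≁b y∈ a∈ y′∈ (<⇒≢ 1<m) (≢m∸ 2<m) j≢m j≢m∸1 (inj₁ refl)

        module _ {v : V} {z : ℕ} (play : Play ((v , z) ∷ t₃)) where
          z≢m : z ≢ m
          z≢m refl = head-unused play (there (here refl))

          -- The edge label `m ∸ 1` needs `m ∸ 1` next to `a` or 1 next to `b`. The former is spent
          -- on a vertex not adjacent to `a`, the latter sits on `y`.
          doomed-elsewhere : v ≢ y′ → z ≡ m ∸ 1 → Doomed ((v , z) ∷ t₃)
          doomed-elsewhere v≢y′ z≡ q ext graceful
            with edge-m∸1 graceful 1<m (ext (there (there (there (here refl))))) (ext (there (there (here refl))))
          ... | inj₂ (v′ , adj , qv′)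
            with Graceful.q-injective graceful (trans qv′ (sym (ext (there (here refl)))))
          ... | refl = y≁b adj
          doomed-elsewhere v≢y′ z≡ q ext graceful | inj₁ (v′ , adj , qv′)
            with Graceful.q-injective graceful (trans qv′ (trans (sym z≡) (sym (ext (here refl)))))
          ... | refl with nbrs adj
          ... | inj₁ refl        = head-free play (here refl)
          ... | inj₂ (inj₁ refl) = v≢y′ refl
          ... | inj₂ (inj₂ refl) = head-free play (there (here refl))

          -- Bob fills `y′` with a spoiling label. Alice's `v` is not adjacent to `a`, but may touch
          -- `y`, `b` and `y′`; all three are counted as neighbours.
          junk : v ≢ y′ → z ≢ m ∸ 1 → BobWins bob (pos ((v , z) ∷ t₃))
          junk v≢y′ z≢m∸1 with spoiler {z} (n≢0⇒n>0 λ { refl → head-unused play (there (there (here refl))) })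
                                           (bounded play (here refl))
          ... | j , j<m , j∉used , j∉E , ∣j-z∣∉E , ∣j-z∣≢j = bob-dooms
            (extend play (free-∷ (v≢y′ ∘ sym) (free-∷ (y≢y′ ∘ sym) (free-∷ y′≢b (free-∷ y′≢a free-[])))) (<⇒≤ j<m)
              (unused-∷ (j∉used ∘ there ∘ there ∘ there ∘ there ∘ here) (unused-∷ (j∉used ∘ there ∘ here)
                (unused-∷ (<⇒≢ j<m) (unused-∷ (j∉used ∘ here) unused-[]))))
              (keep (skip (¬Adj-sym y≁y′) (skip y′≁b (keep none))))
              (edgeLabels-∷ elabs₃ (keep (keep (skip v≁a none))))
              new∉ new-inj)
            (doomed-filled (there (there (there (there (here refl))))) (there (there (here refl))) (here refl)
              (<⇒≢ j<m) (j∉used ∘ there ∘ there ∘ there ∘ here))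
            where
            v≁a : ¬ Adj v a
            v≁a adj with nbrs (Adj-sym adj)
            ... | inj₁ refl        = head-free play (here refl)
            ... | inj₂ (inj₁ refl) = v≢y′ refl
            ... | inj₂ (inj₂ refl) = head-free play (there (here refl))
            E : List ℕ
            E = ∣ z - 1 ∣ ∷ ∣ z - m ∣ ∷ 1 ∷ ∣ m - 0 ∣ ∷ []
            E≡ : E ≡ ∣ z - 1 ∣ ∷ ∣ z - m ∣ ∷ 1 ∷ m ∷ []
            E≡ = cong (λ k → ∣ z - 1 ∣ ∷ ∣ z - m ∣ ∷ 1 ∷ k ∷ []) (∣-∣-identityʳ m)
            new∉ : ∀ {k} → k ∈ z ∷ 0 ∷ [] → ∣ j - k ∣ ∉ E
            new∉ (here refl)         = subst (∣ j - z ∣ ∉_) (sym E≡) ∣j-z∣∉E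
            new∉ (there (here refl)) = subst₂ _∉_ (sym (∣-∣-identityʳ j)) (sym E≡) j∉E
            new-inj : ∀ {k k′} → k ∈ z ∷ 0 ∷ [] → k′ ∈ z ∷ 0 ∷ [] → ∣ j - k ∣ ≡ ∣ j - k′ ∣ → k ≡ k′
            new-inj (here refl)         (here refl)         _  = refl
            new-inj (here refl)         (there (here refl)) eq = ⊥-elim (∣j-z∣≢j (trans eq (∣-∣-identityʳ j)))
            new-inj (there (here refl)) (here refl)         eq = ⊥-elim (∣j-z∣≢j (trans (sym eq) (∣-∣-identityʳ j)))
            new-inj (there (here refl)) (there (here refl)) _  = refl

        -- With 2 on `u`, the edge label `m ∸ 2` has no place: the neighbours of 0 carry 1, `m ∸ 1`
        -- and `m`, the vertices of 1 and `m ∸ 1` are not adjacent, nor are those of 2 and `m`.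
        last : Play ((y′ , m ∸ 1) ∷ t₃) → BobWins bob (pos ((y′ , m ∸ 1) ∷ t₃))
        last play = bob-dooms
          (extend-isolated play (free-∷ u≢y′ (free-∷ u≢y (free-∷ u≢b (free-∷ (col≢ (next²≢ i)) free-[])))) (<⇒≤ 2<m)
            (unused-∷ (≢m∸ (<m (s≤s (s≤s (s≤s (s≤s z≤n)))))) (unused-∷ (λ ()) (unused-∷ (<⇒≢ 2<m) (unused-∷ (λ ()) unused-[]))))
            (skip (¬Adj-sym y′≁u) (skip (¬Adj-sym y≁u) (skip (¬Adj-sym b≁u) (skip (¬Adj-sym a≁u) none)))))
          doomed
          where
          doomed : Doomed ((u , 2) ∷ (y′ , m ∸ 1) ∷ t₃)
          doomed q ext graceful with edge-m∸2 graceful 2<m (ext (there (there (there (there (here refl))))))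
                                       (ext (there (there (there (here refl))))) (ext (there (there (here refl))))
                                       (ext (there (here refl)))
          ... | inj₂ (inj₂ adj) = y≁y′ adj
          ... | inj₂ (inj₁ (v , adj , qv)) with Graceful.q-injective graceful (trans qv (sym (ext (here refl))))
          ... | refl = b≁u (Adj-sym adj)
          doomed q ext graceful | inj₁ (v , adj , qv) with nbrs adj
          ... | inj₁ refl        = ≢m∸ {1} {2} (<m (s≤s (s≤s (s≤s (s≤s z≤n))))) (trans (sym (ext (there (there (here refl))))) qv)
          ... | inj₂ (inj₁ refl) = >⇒≢ (∸-monoʳ-< {m} {2} {1} (s≤s (s≤s z≤n)) (<⇒≤ 2<m)) (trans (sym (ext (there (here refl)))) qv)
          ... | inj₂ (inj₂ refl) = >⇒≢ (∸-monoʳ-< {m} {2} {0} (s≤s z≤n) (<⇒≤ 2<m)) (trans (sym (ext (there (there (there (here refl)))))) qv)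

        bob-wins : Play t₂ → BobWins bob (pos t₂)
        bob-wins play₂ = bob-turn play₃ (alice-turn play₃ (¬complete {t₃} {y′}
            (free-∷ (y≢y′ ∘ sym) (free-∷ y′≢b (free-∷ y′≢a free-[])))) reply)
          where
          play₃ : Play t₃
          play₃ = extend-pendant play₂ (free-∷ y≢b (free-∷ y≢a free-[])) (<⇒≤ 1<m)
            (unused-∷ (<⇒≢ 1<m) (unused-∷ (λ ()) unused-[])) (skip y≁b (keep none)) elabs₂
            (λ { (here eq) → <⇒≢ 1<m (trans eq (∣-∣-identityʳ m)) })
          reply : ∀ {v z} → Play ((v , z) ∷ t₃) → BobWins bob (pos ((v , z) ∷ t₃))
          reply {v} {z} play with v ≟V y′ | z ≟ m ∸ 1
          ... | yes refl | yes refl = last play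
          ... | yes refl | no z≢    = doomed⇒win play
            (doomed-filled (there (there (there (here refl)))) (there (here refl)) (here refl) (z≢m play) z≢) bob
          ... | no v≢    | yes z≡   = doomed⇒win play (doomed-elsewhere play v≢ z≡) bob
          ... | no v≢    | no z≢    = junk play v≢ z≢

      far : ∀ {v z u′} → ¬ Adj a u′ → Play ((u′ , m) ∷ (v , z) ∷ t₁) → BobWins bob (pos ((v , z) ∷ t₁))
      far a≁u′ play = bob-dooms play (doomed-apart 0<m (there (there (here refl))) (here refl) a≁u′)

      m-unused : ∀ {v z} → z ≢ m → Unused ((v , z) ∷ t₁) m
      m-unused z≢m = unused-∷ (z≢m ∘ sym) (unused-∷ (>⇒≢ 0<m) unused-[])

      elabs : ∀ {v z} → ¬ Adj a v → EdgeLabels ((v , z) ∷ t₁) []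
      elabs a≁v = edgeLabels-∷ (edgeLabels-∷ edgeLabels-[] none) (skip (¬Adj-sym a≁v) none)

      u-free : ∀ {v z} → v ≢ u → Free ((v , z) ∷ t₁) u
      u-free v≢u = free-∷ (v≢u ∘ sym) (free-∷ (col≢ (next²≢ i)) free-[])

      -- Unless Alice answers `m`, Bob puts `m` away from 0, on `u` or, if she took that, on
      -- `(i₁ , s′)`. If `v` is adjacent to `a`, it is not adjacent to `u`; otherwise no edge is
      -- labelled yet and a single new label cannot clash.
      reply : ∀ {v z} → Play ((v , z) ∷ t₁) → BobWins bob (pos ((v , z) ∷ t₁))
      reply {v} {z} play with z ≟ m
      ... | no z≢m with v ≟V u
      ... | yes refl = far {u′ = i₁ , s′} (¬adj-skew (next≢ i ∘ sym) s≢s′)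
        (extend-pendant play (free-∷ (col≢ (next≢ i₁ ∘ sym)) (free-∷ (row≢ s′≢s) free-[])) ≤-refl (m-unused z≢m)
          (keep (skip (¬adj-skew (next≢ i) s′≢s) none)) (elabs a≁u) (λ ()))
      ... | no v≢u with adj? a v
      ... | no a≁v = far a≁u (extend-pendant play (u-free v≢u) ≤-refl (m-unused z≢m)
                       (keep (skip (¬Adj-sym a≁u) none)) (elabs a≁v) (λ ()))
      ... | yes adj = far a≁u (extend-isolated play (u-free v≢u) ≤-refl (m-unused z≢m)
                        (skip (u≁v (a-nbrs adj)) (skip (¬Adj-sym a≁u) none)))
        where
        u≁v : v ≡ n₁ ⊎ v ≡ n₂ ⊎ v ≡ n₃ → ¬ Adj u v
        u≁v (inj₁ refl)        = ¬Adj-sym n₁≁u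
        u≁v (inj₂ (inj₁ refl)) = ¬Adj-sym n₂≁u
        u≁v (inj₂ (inj₂ refl)) = ¬Adj-sym n₃≁u
      reply {v} play | yes refl with adj? a v
      ... | no a≁v = doomed⇒win play (doomed-apart 0<m (there (here refl)) (here refl) a≁v) bob
      ... | yes adj with a-nbrs adj
      ... | inj₁ refl = Endgame.bob-wins {n₁} {n₂} {n₃} (Sum.assocʳ ∘ Sum.swap ∘ a-nbrs)
        (row≢ s≢s′) (col≢ (prev≢next i ∘ sym)) (row≢ s≢s′) (col≢ (next≢ i)) (col≢ (prev≢ i))
        (¬Adj-sym n₁≁n₂) n₂≁n₃ (¬Adj-sym n₁≁n₃)
        (col≢ (next²≢ i)) (row≢ s′≢s) (row≢ s′≢s) n₁≁u n₂≁u n₃≁u play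
      ... | inj₂ (inj₁ refl) = Endgame.bob-wins {n₂} {n₁} {n₃} (Sum.map₂ Sum.swap ∘ a-nbrs)
        (row≢ s′≢s) (row≢ s′≢s) (col≢ (prev≢next i)) (row≢ s′≢s) (col≢ (prev≢ i))
        n₁≁n₂ n₁≁n₃ (¬Adj-sym n₂≁n₃)
        (row≢ s′≢s) (col≢ (next²≢ i)) (row≢ s′≢s) n₂≁u n₁≁u n₃≁u play
      ... | inj₂ (inj₂ refl) = Endgame.bob-wins {n₃} {n₁} {n₂} a-nbrs
        (row≢ s′≢s) (row≢ s′≢s) (col≢ (prev≢next i ∘ sym)) (row≢ s′≢s) (col≢ (next≢ i))
        n₁≁n₃ n₁≁n₂ n₂≁n₃
        (row≢ s′≢s) (col≢ (next²≢ i)) (row≢ s′≢s) n₃≁u n₁≁u n₂≁u play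

    bob-wins : BobWins bob empty
    bob-wins = bob-turn play₁ (alice-turn play₁ (¬complete {t₁} {n₁} (free-∷ (row≢ s′≢s) free-[])) reply)
      where
      play₁ : Play t₁
      play₁ = extend-isolated [] free-[] z≤n unused-[] none

large-prism : ∀ n (es : List ((Fin (4 + n) × Fin 2) × (Fin (4 + n) × Fin 2))) → IsPrismEdges (suc n) es → (first : Player) →
  BobWinsGracefulGame (record { V = Graph.V (Prism (4 + n)) ; _≟V_ = Graph._≟V_ (Prism (4 + n)) ; edges = es }) first
large-prism n es isPrism bob = BobFirst.bob-wins fzero {fzero} {fsuc fzero} (λ ())
  where open LargePrism n es isPrism identity
large-prism n es isPrism alice = alice-turn [] (¬complete {[]} {fzero , fzero} free-[]) reply
  where
  open LargePrism n es isPrism identity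
  module C = LargePrism n es isPrism complement
  reply : ∀ {v l} → Play ((v , l) ∷ []) → BobWins bob (pos ((v , l) ∷ []))
  reply {v} {l} play@((l≤m , legal) ∷ []) with m ∸ 1 ≤? l
  ... | no m∸1≰l = reply-to-first play (λ { refl → m∸1≰l (m∸n≤m m 1) }) (λ { refl → m∸1≰l ≤-refl })
  -- Alice's `l` is `m` or `m ∸ 1`. Recorded through the complement it is 0 or 1, and the board is
  -- the same since m ∸ (m ∸ l) = l.
  ... | yes m∸1≤l = subst (λ k → BobWins bob (assign empty v k)) (m∸[m∸n]≡n l≤m)
    (C.reply-to-first ((m∸n≤m m l , subst (Legal empty v) (sym (m∸[m∸n]≡n l≤m)) legal) C.∷ C.[])
      (<⇒≢ (<-≤-trans m∸l<2 (<⇒≤ 2<m))) (<⇒≢ (<-≤-trans m∸l<2 (∸-monoˡ-≤ 1 2<m))))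
    where
    m∸l<2 : m ∸ l < 2
    m∸l<2 = s≤s (m≤n+o⇒m∸n≤o m l (≤-trans (m≤n+m∸n m 1) (≤-trans (+-monoʳ-≤ 1 m∸1≤l) (≤-reflexive (+-comm 1 l)))))

-- The triangular prism

-- Asking for does d ≡ true makes the type checker evaluate d much faster than toWitness.
fromDoes : ∀ {P : Set} (d : Dec P) → does d ≡ true → P
fromDoes (yes p) _ = p

module TriangularPrism where
  open PrismGame 0 (prismEdges 3) (isPrismEdges 0) identity public

  -- An upper estimate of the labels `v` can have in a graceful extension: clashes between edge
  -- labels are ignored.
  Possible : Moves → V → ℕ → Set
  Possible s v l = pos s v ≡ just l ⊎ (pos s v ≡ nothing × All ((l ≢_) ∘ proj₂) s)

  possible? : ∀ s v l → Dec (Possible s v l)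
  possible? s v l = maybe-≡-dec _≟_ (pos s v) (just l)
    ⊎-dec (maybe-≡-dec _≟_ (pos s v) nothing ×-dec All.all? (λ (_ , k) → ¬? (l ≟ k)) s)

  -- `l` stands for the smaller end of the edge, at most `9 ∸ d` because m = 9 here; either vertex
  -- may be the smaller end.
  Missing : Moves → ℕ → Set
  Missing s d = All (λ (u , v) → All (λ l →
      ¬ (Possible s u l × Possible s v (l + d)) × ¬ (Possible s v l × Possible s u (l + d)))
    (upTo (suc (9 ∸ d)))) edges

  missing? : ∀ s d → Dec (Missing s d)
  missing? s d = All.all? (λ (u , v) → All.all? (λ l →
      ¬? (possible? s u l ×-dec possible? s v (l + d)) ×-dec ¬? (possible? s v l ×-dec possible? s u (l + d)))
    (upTo (suc (9 ∸ d)))) edges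

  Stuck : Moves → Set
  Stuck s = Any (λ v → pos s v ≡ nothing × All (λ l → ¬ Legal (pos s) v l) (upTo 10)) vertices

  stuck? : ∀ s → Dec (Stuck s)
  stuck? s = Any.any? (λ v → maybe-≡-dec _≟_ (pos s v) nothing
    ×-dec All.all? (λ l → ¬? (legal? (pos s) v l)) (upTo 10)) vertices

  module _ {s : Moves} (play : Play s) {q : V → ℕ} (ext : ∀ {u l} → (u , l) ∈ s → q u ≡ l) (graceful : Graceful q) where
    open Graceful graceful

    nothing⇒free : ∀ {v} → pos s v ≡ nothing → Free s v
    nothing⇒free eq v∈ with trans (sym (∈⇒pos play v∈)) eq
    ... | ()

    unused-value : ∀ {v} → pos s v ≡ nothing → Unused s (q v)
    unused-value eq u∈ with q-injective (ext u∈)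
    ... | refl = nothing⇒free eq u∈

    possible : ∀ v → Possible s v (q v)
    possible v with pos s v in eq
    ... | just k  = inj₁ (cong just (trans k≡l (sym (ext v∈))))
      where
      v∈  = proj₁ (proj₂ (pos⇒∈ s eq))
      k≡l = proj₂ (proj₂ (pos⇒∈ s eq))
    ... | nothing = inj₂ (refl , All.tabulate λ {(u , k)} u∈ eq′ →
      unused-value eq (subst (λ x → (u , x) ∈ s) (sym eq′) u∈))

    ¬missing : ∀ {d} → 1 ≤ d → d ≤ 9 → ¬ Missing s d
    ¬missing {d} 1≤d d≤9 missing with edge-label 1≤d d≤9
    ... | u , v , adj , eq = case adj
      where
      in-range : q u ∈ upTo (suc (9 ∸ d))
      in-range = ∈-upTo⁺ (s≤s (m+n≤o⇒m≤o∸n (q u) (≤-trans (≤-reflexive (sym eq)) (q-bounded v))))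
      both : Possible s u (q u) × Possible s v (q u + d)
      both = possible u , subst (Possible s v) eq (possible v)
      case : Adj u v → ⊥
      case (inj₁ e) = proj₁ (All.lookup (All.lookup missing e) in-range) both
      case (inj₂ e) = proj₂ (All.lookup (All.lookup missing e) in-range) both

    -- Restricted to `v` and the vertices labelled so far, a graceful extension still has distinct
    -- edge labels. So a free vertex without legal label dooms the position.
    legal-value : ∀ {v} → pos s v ≡ nothing → Legal (pos s) v (q v)
    legal-value {v} eq = record
      { free     = eq
      ; inRange  = q-bounded v
      ; unused   = λ w eq′ → let l , w∈ , e = pos⇒∈ s eq′ in unused-value eq (subst (λ x → (w , x) ∈ s) (sym e) w∈)
      ; distinct = mapMaybe-unique⁺ (edgeLabel p′) edges-unique λ {e} {e′} e∈ e′∈ le le′ →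
          q-distinct e∈ e′∈ (trans (sym (agree e le)) (agree e′ le′))
      }
      where
      p′ : Position
      p′ = assign (pos s) v (q v)
      value : ∀ u {k} → p′ u ≡ just k → q u ≡ k
      value u eq′ with u ≟V v
      ... | yes refl = just-injective eq′
      ... | no _     = let l , u∈ , e = pos⇒∈ s eq′ in trans (ext u∈) (sym e)
      agree : ∀ e {k} → edgeLabel p′ e ≡ just k → k ≡ lab e
      agree (u , w) le = let i , j , ei , ej , k≡ = edgeLabel⁻ p′ u w le in
        trans k≡ (sym (cong₂ ∣_-_∣ (value u ei) (value w ej)))

    ¬stuck : ¬ Stuck s
    ¬stuck stuck with find stuck
    ... | v , _ , eq , illegal = All.lookup illegal (∈-upTo⁺ (s≤s (q-bounded v))) (legal-value eq)

  -- Found by computer search; where the plan is silent a single further move of Bob decides, and it is searched for.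
  plan : Moves → Maybe (V × ℕ)
  plan []                    = just ((fzero , fzero) , 0)
  plan (((i , s) , 0) ∷ [])  = just ((cycNext i , flip s) , 9)
  plan (((i , s) , 1) ∷ [])  = just ((i , flip s) , 0)
  plan (((i , s) , 8) ∷ [])  = just ((i , flip s) , 9)
  plan (((i , s) , 9) ∷ [])  = just ((cycNext i , flip s) , 0)
  plan (((i , s) , x) ∷ []) with x ≤? 4
  ... | yes _ = just ((cycNext i , s) , 9)
  ... | no _  = just ((cycNext i , s) , 0)
  plan (((fzero , fsuc fzero) , 9)        ∷ _ ∷ []) = just ((fsuc fzero , fzero) , 1)
  plan (((fsuc fzero , fzero) , 9)        ∷ _ ∷ []) = just ((fsuc (fsuc fzero) , fzero) , 2)
  plan (((fsuc (fsuc fzero) , fzero) , 9) ∷ _ ∷ []) = just ((fsuc fzero , fzero) , 2)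
  plan _ = nothing

  -- Labels vary slowest in `candidates`, extreme ones first: these tend to decide, so the search
  -- stops early.
  candidates moves : List (ℕ × V)
  candidates = cartesianProduct (9 ∷ 0 ∷ 1 ∷ 8 ∷ 2 ∷ 7 ∷ 3 ∷ 4 ∷ 5 ∷ 6 ∷ []) vertices
  moves      = cartesianProduct (upTo 10) vertices

  -- The test for Stuck is costly and needed only when Bob opens.
  module Search (useStuck : Bool) where

    Dead : Moves → Set
    Dead s = Missing s 9 ⊎ Missing s 8 ⊎ (T useStuck × Stuck s)

    dead? : ∀ s → Dec (Dead s)
    dead? s = missing? s 9 ⊎-dec missing? s 8 ⊎-dec (T? useStuck ×-dec stuck? s)

    dead⇒doomed : ∀ {s} → Play s → Dead s → Doomed s
    dead⇒doomed play (inj₁ missing)            q ext graceful = ¬missing play ext graceful (s≤s z≤n) ≤-refl missing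
    dead⇒doomed play (inj₂ (inj₁ missing))     q ext graceful = ¬missing play ext graceful (s≤s z≤n) (n≤1+n 8) missing
    dead⇒doomed play (inj₂ (inj₂ (_ , stuck))) q ext graceful = ¬stuck play ext graceful stuck

    -- `f` counts the planned moves left to Bob and makes the recursion structural. A deciding move
    -- found by search is not charged.
    BobW AliceW : ℕ → Moves → Set
    Planned : ℕ → Moves → Maybe (V × ℕ) → Set
    BobW f s = Dead s ⊎ Planned f s (plan s)
    Planned zero    s (just _)       = ⊥
    Planned (suc f) s (just (v , l)) = Legal (pos s) v l × AliceW f ((v , l) ∷ s)
    Planned f       s nothing        = Any (λ (l , v) → Legal (pos s) v l × Dead ((v , l) ∷ s)) candidates
    AliceW f s = Any (λ v → pos s v ≡ nothing) vertices
               × All (λ (l , v) → ¬ Legal (pos s) v l ⊎ BobW f ((v , l) ∷ s)) moves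

    bobW?    : ∀ f s → Dec (BobW f s)
    planned? : ∀ f s o → Dec (Planned f s o)
    aliceW?  : ∀ f s → Dec (AliceW f s)
    bobW? f s = dead? s ⊎-dec planned? f s (plan s)
    planned? zero    s (just _)       = no λ ()
    planned? (suc f) s (just (v , l)) = legal? (pos s) v l ×-dec aliceW? f ((v , l) ∷ s)
    planned? zero    s nothing        = Any.any? (λ (l , v) → legal? (pos s) v l ×-dec dead? ((v , l) ∷ s)) candidates
    planned? (suc f) s nothing        = Any.any? (λ (l , v) → legal? (pos s) v l ×-dec dead? ((v , l) ∷ s)) candidates
    aliceW? f s = Any.any? (λ v → maybe-≡-dec _≟_ (pos s v) nothing) vertices
      ×-dec All.all? (λ (l , v) → ¬? (legal? (pos s) v l) ⊎-dec bobW? f ((v , l) ∷ s)) moves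

    bobW-sound    : ∀ f {s} → Play s → BobW f s → BobWins bob (pos s)
    planned-sound : ∀ f {s} → Play s → ∀ o → Planned f s o → BobWins bob (pos s)
    aliceW-sound  : ∀ f {s} → Play s → AliceW f s → BobWins alice (pos s)
    immediate     : ∀ {s} → Play s → Any (λ (l , v) → Legal (pos s) v l × Dead ((v , l) ∷ s)) candidates → BobWins bob (pos s)

    immediate play found with Any.satisfied found
    ... | (l , v) , legal , dead = bob-dooms play′ (dead⇒doomed play′ dead)
      where play′ = (Legal.inRange legal , legal) ∷ play

    bobW-sound f play (inj₁ dead)    = doomed⇒win play (dead⇒doomed play dead) bob
    bobW-sound f play (inj₂ planned) = planned-sound f play _ planned
    planned-sound (suc f) play (just (v , l)) (legal , win) = bob-turn play′ (aliceW-sound f play′ win)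
      where play′ = (Legal.inRange legal , legal) ∷ play
    planned-sound zero    play nothing found = immediate play found
    planned-sound (suc f) play nothing found = immediate play found
    aliceW-sound f {s} play (someFree , replies) = alice-turn play
      (λ complete → let v , eq = Any.satisfied someFree in absurd (complete v) eq)
      reply
      where
      absurd : ∀ {o : Maybe ℕ} → Is-just o → o ≢ nothing
      absurd {just _} _ ()
      reply : ∀ {v l} → Play ((v , l) ∷ s) → BobWins bob (pos ((v , l) ∷ s))
      reply {v} {l} play′@((l≤9 , legal) ∷ _)
        with All.lookup replies (∈-cartesianProduct⁺ (∈-upTo⁺ (s≤s l≤9)) (∈-vertices v))
      ... | inj₁ illegal = ⊥-elim (illegal legal)
      ... | inj₂ win     = bobW-sound f play′ win

  triangular-prism : (first : Player) → BobWinsGracefulGame (Prism 3) first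
  -- Bob makes one planned move if Alice opens, and at most two if he opens himself.
  triangular-prism alice = aliceW-sound 1 [] (fromDoes (aliceW? 1 []) refl)
    where open Search false
  triangular-prism bob   = bobW-sound 2 [] (fromDoes (bobW? 2 []) refl)
    where open Search true

theorem12 : (r : ℕ) → 3 ≤ r → (first : Player) → BobWinsGracefulGame (Prism r) first
theorem12 3                         (s≤s (s≤s (s≤s _))) = TriangularPrism.triangular-prism
theorem12 (suc (suc (suc (suc n)))) (s≤s (s≤s (s≤s _))) = large-prism n (prismEdges (4 + n)) (isPrismEdges (suc n))
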